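{- Fix integers $r\ge 3$ and $k\ge 4$, and let $n\ge 72$. Then \[ F_{r,k}(n)\ \ge\ \frac{n^2}{12}-\frac{10}{3}n . \]
   Context: For a finite set $A\subset\mathbb{R}^2$, a line $\ell$ is called ordinary (for $A$) if $|\ell\cap A|=2$, and $\operatorname{ord}(A)$ denotes the number of ordinary lines of $A$. For integers $r,k\ge 2$ and $n\ge r$, $F_{r,k}(n)$ is defined as the maximum of $\operatorname{ord}(A)$ over all $n$-point sets $A\subset\mathbb{R}^2$ such that (i) every line $\ell$ satisfies $|\ell\cap A|\le k-1$, and (ii) there is no subset $A'\subset A$ with $|A'|=r$ such that every pair of distinct points of $A'$ spans an ordinary line of $A$. If no such set $A$ exists, $F_{r,k}(n):=-1$. -}

module Defs where

open import Level using (0ℓ)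
open import Data.Nat using (ℕ)
open import Data.Fin using (Fin; _<_; _<?_)
open import Data.Fin.Properties using (all?)
open import Data.Product using (Σ; _×_; _,_; ∃)
open import Data.Product.Relation.Binary.Pointwise.NonDependent using ()
open import Data.Sum using (_⊎_)
open import Data.List using (List; length; filter; cartesianProduct; allFin)
open import Relation.Nullary using (¬_; Dec; yes; no)
open import Relation.Nullary.Decidable using (_×-dec_; _⊎-dec_; _→-dec_; ¬?)
open import Relation.Binary using (Decidable)
open import Relation.Binary.PropositionalEquality using (_≡_)
open import Algebra.Structures using (IsCommutativeRing)
open import Function.Definitions using (Injective)
import Data.Fin.Properties as FinP

-- The real numbers, axiomatised as a (Dedekind-)complete ordered field
-- with decidable equality.  Any two such structures are isomorphic, so
-- quantifying over all of them is the same as talking about ℝ.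

record RealField : Set₁ where
  infixl 6 _+_
  infixl 7 _*_
  infix 4 _<ᵣ_ _≤ᵣ_
  field
    ℝ    : Set
    _+_  : ℝ → ℝ → ℝ
    _*_  : ℝ → ℝ → ℝ
    -_   : ℝ → ℝ
    0ᵣ   : ℝ
    1ᵣ   : ℝ
    isCommutativeRing : IsCommutativeRing _≡_ _+_ _*_ -_ 0ᵣ 1ᵣ
    _≟ᵣ_ : (x y : ℝ) → Dec (x ≡ y)
    0≢1  : ¬ (0ᵣ ≡ 1ᵣ)
    inv  : (x : ℝ) → ¬ (x ≡ 0ᵣ) → Σ ℝ (λ y → x * y ≡ 1ᵣ)
    _<ᵣ_ : ℝ → ℝ → Set
    <-irrefl : ∀ x → ¬ (x <ᵣ x)
    <-trans  : ∀ {x y z} → x <ᵣ y → y <ᵣ z → x <ᵣ z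
    <-trichotomy : ∀ x y → x <ᵣ y ⊎ (x ≡ y ⊎ y <ᵣ x)
    +-mono-<  : ∀ {x y} z → x <ᵣ y → x + z <ᵣ y + z
    *-pos     : ∀ {x y} → 0ᵣ <ᵣ x → 0ᵣ <ᵣ y → 0ᵣ <ᵣ x * y
  _≤ᵣ_ : ℝ → ℝ → Set
  x ≤ᵣ y = x <ᵣ y ⊎ x ≡ y
  UpperBound : (ℝ → Set) → ℝ → Set
  UpperBound P b = ∀ x → P x → x ≤ᵣ b
  field
    sup : (P : ℝ → Set) → ∃ P → ∃ (UpperBound P) →
          Σ ℝ (λ s → UpperBound P s × (∀ b → UpperBound P b → s ≤ᵣ b))

module Plane (R : RealField) where
  open RealField R

  Point : Set
  Point = ℝ × ℝ

  _-ᵣ_ : ℝ → ℝ → ℝ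
  x -ᵣ y = x + (- y)

  record Line : Set where
    field
      a b c : ℝ
      nondeg : ¬ (a ≡ 0ᵣ × b ≡ 0ᵣ)

  _∈ₗ_ : Point → Line → Set
  (x , y) ∈ₗ L = a * x + b * y ≡ c
    where open Line L

  -- p, q, s are collinear (determinant of q - p, s - p vanishes)
  Collinear : Point → Point → Point → Set
  Collinear (px , py) (qx , qy) (sx , sy) =
    (qx -ᵣ px) * (sy -ᵣ py) ≡ (qy -ᵣ py) * (sx -ᵣ px)

  collinear? : ∀ p q s → Dec (Collinear p q s)
  collinear? (px , py) (qx , qy) (sx , sy) =
    ((qx -ᵣ px) * (sy -ᵣ py)) ≟ᵣ ((qy -ᵣ py) * (sx -ᵣ px))

  module _ {n : ℕ} (A : Fin n → Point) where

    OrdinaryPair : Fin n → Fin n → Set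
    OrdinaryPair i j = ¬ (i ≡ j) × (∀ m → Collinear (A i) (A j) (A m) → m ≡ i ⊎ m ≡ j)

    ordinaryPair? : (i j : Fin n) → Dec (OrdinaryPair i j)
    ordinaryPair? i j =
      (¬? (i FinP.≟ j)) ×-dec
      all? (λ m → collinear? (A i) (A j) (A m) →-dec ((m FinP.≟ i) ⊎-dec (m FinP.≟ j)))

    -- ord(A): number of ordinary lines = number of pairs i < j spanning one
    ord : ℕ
    ord = length (filter (λ { (i , j) → (i <? j) ×-dec ordinaryPair? i j })
                         (cartesianProduct (allFin n) (allFin n)))

    -- (i) every line meets A in at most k - 1 points:
    --     no line contains k distinct points of A
    AtMostOnLines : ℕ → Set
    AtMostOnLines k = ∀ (L : Line) (f : Fin k → Fin n) → Injective _≡_ _≡_ f →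
                      ¬ (∀ t → A (f t) ∈ₗ L)

    NoOrdinaryClique : ℕ → Set
    NoOrdinaryClique r = ∀ (f : Fin r → Fin n) → Injective _≡_ _≡_ f →
                         ¬ (∀ s t → ¬ (s ≡ t) → OrdinaryPair (f s) (f t))

{-# OPTIONS --safe #-}
-- Let N = 7m.  On the real cubic through the points (q : p : p³), where (p, q) runs over the pairs
-- (sin aθ, sin (a+1)θ) and θ = π / N, three distinct points with parameters a, b, c mod N are
-- collinear exactly when a + b + c ≡ 0.  Take all 6m parameters prime to 7; -1 and -2 are
-- nonresidues mod 7, so every ordinary pair joins a quadratic residue to a nonresidue, and all
-- 3m² pairs of opposite classes are ordinary.  At most five further parameters divisible by 7 bring
-- the number of points to n; they destroy at most 15m ordinary pairs, and they are chosen so that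
-- the new ordinary pairs form a bipartite graph among themselves.
-- To produce θ, y = 2 cos θ is obtained as the supremum of the reals at which one of the
-- polynomials sin (kθ) / sin θ in y, 0 < k ≤ N, is nonpositive.
module Submission where

open import Defs
open import Algebra.Bundles using (CommutativeRing)
import Algebra.Properties.Ring as RingProperties
import Algebra.Properties.Semiring.Mult.TCOptimised as SemiringMultiples
import Algebra.Solver.Ring as RingSolver
open import Algebra.Solver.Ring.AlmostCommutativeRing
  using (fromCommutativeRing; _-Raw-AlmostCommutative⟶_)
open import Data.Bool using (Bool; true; false)
import Data.Bool.Properties as Bool
open import Data.Empty using (⊥-elim)
open import Data.Fin as Fin
  using (Fin; toℕ; fromℕ<; splitAt; join; combine; remQuot; _↑ˡ_; _↑ʳ_; inject≤)
open import Data.Fin.Patterns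
import Data.Fin.Properties as Fin
open import Data.Integer as ℤ using (ℤ; -[1+_]; _⊖_) renaming (+_ to pos)
import Data.Integer.Properties as ℤ
open import Data.List using (List; length; filter)
open import Data.List.Membership.Propositional using (_∈_)
open import Data.List.Membership.Propositional.Properties
  using (∈-filter⁺; ∈-cartesianProduct⁺; ∈-allFin)
import Data.List.Membership.Setoid.Properties as Membership
open import Data.List.Relation.Unary.Any using (index)
open import Data.Maybe using (Maybe; just; nothing)
open import Data.Nat as ℕ using (ℕ; zero; suc; z≤n; s≤s)
open import Data.Nat.Divisibility
  using (_∣_; _∣?_; divides; ∣m+n∣m⇒∣n; >⇒∤; m%n≡0⇒n∣m; ∣-trans; ∣-reflexive; n∣m*n;
         *-cancelʳ-∣; *-monoˡ-∣)
open import Data.Nat.DivMod using (m≡m%n+[m/n]*n; m%n<n; [m+kn]%n≡m%n; _divMod_; result)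
import Data.Nat.Properties as ℕ
open import Data.Nat.Tactic.RingSolver using (solve-∀)
open import Data.Product using (Σ; ∃; _×_; _,_; proj₁; proj₂)
open import Data.Product.Properties using (,-injective; ,-injectiveˡ; ,-injectiveʳ)
open import Data.Sum using (_⊎_; inj₁; inj₂; [_,_]′; map₁)
open import Data.Sum.Properties using (inj₁-injective; inj₂-injective)
open import Function using (id; _∘_)
open import Function.Definitions using (Injective)
open import Level using (0ℓ)
open import Relation.Binary.Definitions using (tri<; tri≈; tri>)
open import Relation.Binary.PropositionalEquality
open import Relation.Nullary using (¬_; Dec; yes; no)
open import Relation.Nullary.Decidable using (from-yes; _×-dec_; _→-dec_; ¬?)
open import Relation.Unary using (Decidable)

-- The curve is the cubic Z(X² - yXY + Y²) = Y³ with y = 2 cos θ. Its singular point (0 : 0 : 1) is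
-- isolated, so its smooth real points form a circle group, which has a cyclic subgroup of every
-- order N. In the full subgroup, a line through two points either meets a third one or is tangent
-- at one of the two. Deleting the parameters divisible by 7 frees exactly the lines whose third
-- point was deleted, and these join opposite classes. With a prime P in place of 7, the n = (P -
-- 1)m remaining points have (P - 1)m²/2 = n²/(2(P - 1)) pairs of opposite classes, so P should be
-- small. The least odd prime for which -1 and -2 are both nonresidues is 7, whence the 12. A pair
-- of one old and one added point is never ordinary: if the old one has class r, the third point has
-- class -r, and that whole class is present. The ordinary pairs therefore form two bipartite graphs
-- with no edge between them, and no triangle occurs.

module IntegerCoefficients (R : RealField) where
  open RealField R

  commutativeRing : CommutativeRing 0ℓ 0ℓ
  commutativeRing = record { isCommutativeRing = isCommutativeRing }

  open CommutativeRing commutativeRing public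
    using (+-assoc; +-comm; +-identityˡ; +-identityʳ; -‿inverseʳ;
           *-assoc; *-identityˡ; zeroˡ; zeroʳ; distribʳ; ring; semiring)
  open RingProperties ring public
    using (-0#≈0#; -‿involutive; -‿+-comm; -‿distribˡ-*; -‿distribʳ-*)
  open SemiringMultiples semiring using (1+×; ×-homo-+; ×1-homo-*) renaming (_×_ to _×ᵣ_)

  -- The carrier ℝ is abstract, so its constants do not compute. The solver normalises polynomials
  -- with coefficients in ℤ, where equality is decided by evaluation, and interprets them through
  -- this morphism.
  ⟦_⟧ : ℤ → ℝ
  ⟦ pos n ⟧ = n ×ᵣ 1ᵣ
  ⟦ -[1+ n ] ⟧ = - (suc n ×ᵣ 1ᵣ)

  ⟦⟧-⊖ : ∀ m n → ⟦ m ⊖ n ⟧ ≡ m ×ᵣ 1ᵣ + - (n ×ᵣ 1ᵣ)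
  ⟦⟧-⊖ m zero = sym (trans (cong (m ×ᵣ 1ᵣ +_) -0#≈0#) (+-identityʳ _))
  ⟦⟧-⊖ zero (suc n) = sym (+-identityˡ _)
  ⟦⟧-⊖ (suc m) (suc n) = begin
    ⟦ suc m ⊖ suc n ⟧                     ≡⟨ cong ⟦_⟧ (ℤ.[1+m]⊖[1+n]≡m⊖n m n) ⟩
    ⟦ m ⊖ n ⟧                             ≡⟨ ⟦⟧-⊖ m n ⟩
    a + - b                               ≡⟨ cong (_+ - b) (+-identityʳ a) ⟨
    (a + 0ᵣ) + - b                        ≡⟨ cong (λ z → (a + z) + - b) (-‿inverseʳ 1ᵣ) ⟨
    (a + (1ᵣ + - 1ᵣ)) + - b               ≡⟨ cong (_+ - b) (+-assoc a 1ᵣ (- 1ᵣ)) ⟨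
    ((a + 1ᵣ) + - 1ᵣ) + - b               ≡⟨ +-assoc (a + 1ᵣ) (- 1ᵣ) (- b) ⟩
    (a + 1ᵣ) + (- 1ᵣ + - b)               ≡⟨ cong₂ _+_ (+-comm a 1ᵣ) (-‿+-comm 1ᵣ b) ⟩
    (1ᵣ + a) + - (1ᵣ + b)                 ≡⟨ cong₂ (λ x z → x + - z) (1+× m 1ᵣ) (1+× n 1ᵣ) ⟨
    suc m ×ᵣ 1ᵣ + - (suc n ×ᵣ 1ᵣ)         ∎
    where
      open ≡-Reasoning
      a = m ×ᵣ 1ᵣ
      b = n ×ᵣ 1ᵣ

  ⟦⟧-neg : ∀ i → ⟦ ℤ.- i ⟧ ≡ - ⟦ i ⟧
  ⟦⟧-neg (pos zero) = sym -0#≈0#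
  ⟦⟧-neg (pos (suc n)) = refl
  ⟦⟧-neg -[1+ n ] = sym (-‿involutive _)

  ⟦⟧-+ : ∀ i j → ⟦ i ℤ.+ j ⟧ ≡ ⟦ i ⟧ + ⟦ j ⟧
  ⟦⟧-+ (pos m) (pos n) = ×-homo-+ 1ᵣ m n
  ⟦⟧-+ (pos m) -[1+ n ] = ⟦⟧-⊖ m (suc n)
  ⟦⟧-+ -[1+ m ] (pos n) = trans (⟦⟧-⊖ n (suc m)) (+-comm _ _)
  ⟦⟧-+ -[1+ m ] -[1+ n ] = begin
    ⟦ -[1+ m ] ℤ.+ -[1+ n ] ⟧             ≡⟨ cong ⟦_⟧ (ℤ.neg-distrib-+ (pos (suc m)) (pos (suc n))) ⟨
    - ((suc m ℕ.+ suc n) ×ᵣ 1ᵣ)           ≡⟨ cong -_ (×-homo-+ 1ᵣ (suc m) (suc n)) ⟩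
    - (suc m ×ᵣ 1ᵣ + suc n ×ᵣ 1ᵣ)         ≡⟨ -‿+-comm _ _ ⟨
    - (suc m ×ᵣ 1ᵣ) + - (suc n ×ᵣ 1ᵣ)     ∎
    where open ≡-Reasoning

  ⟦⟧-*-pos : ∀ m j → ⟦ pos m ℤ.* j ⟧ ≡ ⟦ pos m ⟧ * ⟦ j ⟧
  ⟦⟧-*-pos m (pos n) = trans (cong ⟦_⟧ (sym (ℤ.pos-* m n))) (×1-homo-* m n)
  ⟦⟧-*-pos m -[1+ n ] = begin
    ⟦ pos m ℤ.* -[1+ n ] ⟧                ≡⟨ cong ⟦_⟧ (ℤ.neg-distribʳ-* (pos m) (pos (suc n))) ⟨
    ⟦ ℤ.- (pos m ℤ.* pos (suc n)) ⟧       ≡⟨ ⟦⟧-neg (pos m ℤ.* pos (suc n)) ⟩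
    - ⟦ pos m ℤ.* pos (suc n) ⟧           ≡⟨ cong -_ (⟦⟧-*-pos m (pos (suc n))) ⟩
    - (⟦ pos m ⟧ * (suc n ×ᵣ 1ᵣ))         ≡⟨ -‿distribʳ-* _ _ ⟩
    ⟦ pos m ⟧ * - (suc n ×ᵣ 1ᵣ)           ∎
    where open ≡-Reasoning

  ⟦⟧-* : ∀ i j → ⟦ i ℤ.* j ⟧ ≡ ⟦ i ⟧ * ⟦ j ⟧
  ⟦⟧-* (pos m) j = ⟦⟧-*-pos m j
  ⟦⟧-* -[1+ m ] j = begin
    ⟦ -[1+ m ] ℤ.* j ⟧                    ≡⟨ cong ⟦_⟧ (ℤ.neg-distribˡ-* (pos (suc m)) j) ⟨
    ⟦ ℤ.- (pos (suc m) ℤ.* j) ⟧           ≡⟨ ⟦⟧-neg (pos (suc m) ℤ.* j) ⟩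
    - ⟦ pos (suc m) ℤ.* j ⟧               ≡⟨ cong -_ (⟦⟧-*-pos (suc m) j) ⟩
    - ((suc m ×ᵣ 1ᵣ) * ⟦ j ⟧)             ≡⟨ -‿distribˡ-* _ _ ⟩
    - (suc m ×ᵣ 1ᵣ) * ⟦ j ⟧               ∎
    where open ≡-Reasoning

  ⟦⟧-morphism : ℤ.+-*-rawRing -Raw-AlmostCommutative⟶ fromCommutativeRing commutativeRing
  ⟦⟧-morphism = record
    { ⟦_⟧ = ⟦_⟧ ; +-homo = ⟦⟧-+ ; *-homo = ⟦⟧-* ; -‿homo = ⟦⟧-neg
    ; 0-homo = refl ; 1-homo = refl }

  _≟⟦⟧_ : ∀ i j → Maybe (⟦ i ⟧ ≡ ⟦ j ⟧)
  i ≟⟦⟧ j with i ℤ.≟ j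
  ... | yes i≡j = just (cong ⟦_⟧ i≡j)
  ... | no _ = nothing

  open RingSolver ℤ.+-*-rawRing (fromCommutativeRing commutativeRing) ⟦⟧-morphism _≟⟦⟧_ public
    using (solve; Polynomial; con; _:=_; _:+_; _:*_; _:-_; :-_)

-- Ordered field arithmetic and two-sided bounds.

module OrderedField (R : RealField) where
  open RealField R public
  open IntegerCoefficients R public

  infixl 6 _-_
  _-_ : ℝ → ℝ → ℝ
  x - y = x + - y

  2ᵣ : ℝ
  2ᵣ = 1ᵣ + 1ᵣ

  <⇒0<- : ∀ {x y} → x <ᵣ y → 0ᵣ <ᵣ y - x
  <⇒0<- {x} {y} x<y = subst (_<ᵣ y - x) (-‿inverseʳ x) (+-mono-< (- x) x<y)

  0<-⇒< : ∀ {x y} → 0ᵣ <ᵣ y - x → x <ᵣ y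
  0<-⇒< {x} {y} 0<y-x = subst₂ _<ᵣ_ (+-identityˡ x)
    (solve 2 (λ x y → y :- x :+ x := y) refl x y) (+-mono-< x 0<y-x)

  ≤⇒0≤- : ∀ {x y} → x ≤ᵣ y → 0ᵣ ≤ᵣ y - x
  ≤⇒0≤- (inj₁ x<y) = inj₁ (<⇒0<- x<y)
  ≤⇒0≤- (inj₂ refl) = inj₂ (sym (-‿inverseʳ _))

  <⇒≱ : ∀ {x y} → x <ᵣ y → ¬ y ≤ᵣ x
  <⇒≱ x<y (inj₁ y<x) = <-irrefl _ (<-trans x<y y<x)
  <⇒≱ x<y (inj₂ refl) = <-irrefl _ x<y

  ≮⇒≥ : ∀ {x y} → ¬ x <ᵣ y → y ≤ᵣ x
  ≮⇒≥ {x} {y} x≮y with <-trichotomy x y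
  ... | inj₁ x<y = ⊥-elim (x≮y x<y)
  ... | inj₂ (inj₁ x≡y) = inj₂ (sym x≡y)
  ... | inj₂ (inj₂ y<x) = inj₁ y<x

  ≰⇒> : ∀ {x y} → ¬ x ≤ᵣ y → y <ᵣ x
  ≰⇒> {x} {y} x≰y with <-trichotomy x y
  ... | inj₁ x<y = ⊥-elim (x≰y (inj₁ x<y))
  ... | inj₂ (inj₁ x≡y) = ⊥-elim (x≰y (inj₂ x≡y))
  ... | inj₂ (inj₂ y<x) = y<x

  0<⇒≢0 : ∀ {x} → 0ᵣ <ᵣ x → ¬ x ≡ 0ᵣ
  0<⇒≢0 0<x refl = <-irrefl _ 0<x

  +-pos-nonneg : ∀ {x y} → 0ᵣ <ᵣ x → 0ᵣ ≤ᵣ y → 0ᵣ <ᵣ x + y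
  +-pos-nonneg {x} 0<x (inj₂ refl) = subst (0ᵣ <ᵣ_) (sym (+-identityʳ x)) 0<x
  +-pos-nonneg {x} {y} 0<x (inj₁ 0<y) =
    <-trans 0<y (subst (_<ᵣ x + y) (+-identityˡ y) (+-mono-< y 0<x))

  +-nonneg : ∀ {x y} → 0ᵣ ≤ᵣ x → 0ᵣ ≤ᵣ y → 0ᵣ ≤ᵣ x + y
  +-nonneg (inj₁ 0<x) 0≤y = inj₁ (+-pos-nonneg 0<x 0≤y)
  +-nonneg {y = y} (inj₂ refl) 0≤y = subst (0ᵣ ≤ᵣ_) (sym (+-identityˡ y)) 0≤y

  *-nonneg : ∀ {x y} → 0ᵣ ≤ᵣ x → 0ᵣ ≤ᵣ y → 0ᵣ ≤ᵣ x * y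
  *-nonneg (inj₁ 0<x) (inj₁ 0<y) = inj₁ (*-pos 0<x 0<y)
  *-nonneg {x} (inj₁ 0<x) (inj₂ refl) = inj₂ (sym (zeroʳ x))
  *-nonneg {y = y} (inj₂ refl) 0≤y = inj₂ (sym (zeroˡ y))

  neg-pos : ∀ {x} → x <ᵣ 0ᵣ → 0ᵣ <ᵣ - x
  neg-pos {x} x<0 = subst (0ᵣ <ᵣ_) (+-identityˡ (- x)) (<⇒0<- x<0)

  neg-pos⁻¹ : ∀ {x} → 0ᵣ <ᵣ - x → x <ᵣ 0ᵣ
  neg-pos⁻¹ {x} 0<-x = 0<-⇒< (subst (0ᵣ <ᵣ_) (sym (+-identityˡ (- x))) 0<-x)

  0<1 : 0ᵣ <ᵣ 1ᵣ
  0<1 with <-trichotomy 0ᵣ 1ᵣ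
  ... | inj₁ 0<1 = 0<1
  ... | inj₂ (inj₁ 0≡1) = ⊥-elim (0≢1 0≡1)
  ... | inj₂ (inj₂ 1<0) = subst (0ᵣ <ᵣ_)
    (trans (solve 1 (λ o → :- o :* :- o := o :* o) refl 1ᵣ) (*-identityˡ 1ᵣ))
    (*-pos (neg-pos 1<0) (neg-pos 1<0))

  0<x*y⇒0<y : ∀ {x y} → 0ᵣ <ᵣ x → 0ᵣ <ᵣ x * y → 0ᵣ <ᵣ y
  0<x*y⇒0<y {x} {y} 0<x 0<xy = ≰⇒> λ y≤0 → <⇒≱ 0<xy (nonpos y≤0)
    where
    nonpos : y ≤ᵣ 0ᵣ → x * y ≤ᵣ 0ᵣ
    nonpos (inj₂ refl) = inj₂ (zeroʳ x)
    nonpos (inj₁ y<0) = inj₁ (neg-pos⁻¹ (subst (0ᵣ <ᵣ_)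
      (solve 2 (λ x y → x :* :- y := :- (x :* y)) refl x y) (*-pos 0<x (neg-pos y<0))))

  0≤x+x⇒0≤x : ∀ {x} → 0ᵣ ≤ᵣ x + x → 0ᵣ ≤ᵣ x
  0≤x+x⇒0≤x {x} 0≤2x = ≮⇒≥ λ x<0 → <⇒≱ (neg-pos⁻¹ (subst (0ᵣ <ᵣ_)
    (-‿+-comm x x) (+-pos-nonneg (neg-pos x<0) (inj₁ (neg-pos x<0))))) 0≤2x

  x*y≡0⇒y≡0 : ∀ {x y} → ¬ x ≡ 0ᵣ → x * y ≡ 0ᵣ → y ≡ 0ᵣ
  x*y≡0⇒y≡0 {x} {y} x≢0 xy≡0 with inv x x≢0
  ... | x⁻¹ , xx⁻¹≡1 = begin
    y               ≡⟨ *-identityˡ y ⟨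
    1ᵣ * y          ≡⟨ cong (_* y) xx⁻¹≡1 ⟨
    x * x⁻¹ * y     ≡⟨ solve 3 (λ x i y → x :* i :* y := i :* (x :* y)) refl x x⁻¹ y ⟩
    x⁻¹ * (x * y)   ≡⟨ cong (x⁻¹ *_) xy≡0 ⟩
    x⁻¹ * 0ᵣ        ≡⟨ zeroʳ x⁻¹ ⟩
    0ᵣ              ∎
    where open ≡-Reasoning

  *-nonzero : ∀ {x y} → ¬ x ≡ 0ᵣ → ¬ y ≡ 0ᵣ → ¬ x * y ≡ 0ᵣ
  *-nonzero x≢0 y≢0 xy≡0 = y≢0 (x*y≡0⇒y≡0 x≢0 xy≡0)

  x-y≡0⇒x≡y : ∀ {x y} → x - y ≡ 0ᵣ → x ≡ y
  x-y≡0⇒x≡y {x} {y} x-y≡0 = trans (solve 2 (λ x y → x := x :- y :+ y) refl x y)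
    (trans (cong (_+ y) x-y≡0) (+-identityˡ y))

  x≡y⇒x-y≡0 : ∀ {x y} → x ≡ y → x - y ≡ 0ᵣ
  x≡y⇒x-y≡0 refl = -‿inverseʳ _

  infix 4 ∣_∣≤_
  ∣_∣≤_ : ℝ → ℝ → Set
  ∣ x ∣≤ b = 0ᵣ ≤ᵣ b - x × 0ᵣ ≤ᵣ b + x

  ∣∣≤⇒0≤ : ∀ {x b} → ∣ x ∣≤ b → 0ᵣ ≤ᵣ b
  ∣∣≤⇒0≤ {x} {b} (l , u) = 0≤x+x⇒0≤x (subst (0ᵣ ≤ᵣ_)
    (solve 2 (λ x b → b :- x :+ (b :+ x) := b :+ b) refl x b) (+-nonneg l u))

  ∣∣≤-+ : ∀ {x y a b} → ∣ x ∣≤ a → ∣ y ∣≤ b → ∣ x + y ∣≤ a + b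
  ∣∣≤-+ {x} {y} {a} {b} (l , u) (l′ , u′) =
    subst (0ᵣ ≤ᵣ_) (solve 4 (λ x y a b → a :- x :+ (b :- y) := a :+ b :- (x :+ y)) refl x y a b)
      (+-nonneg l l′) ,
    subst (0ᵣ ≤ᵣ_) (solve 4 (λ x y a b → a :+ x :+ (b :+ y) := a :+ b :+ (x :+ y)) refl x y a b)
      (+-nonneg u u′)

  ∣∣≤-neg : ∀ {x b} → ∣ x ∣≤ b → ∣ - x ∣≤ b
  ∣∣≤-neg {x} {b} (l , u) =
    subst (λ z → 0ᵣ ≤ᵣ b + z) (sym (-‿involutive x)) u , l

  -- 2(ab ∓ xy) = (a - x)(b ± y) + (a + x)(b ∓ y)
  ∣∣≤-* : ∀ {x y a b} → ∣ x ∣≤ a → ∣ y ∣≤ b → ∣ x * y ∣≤ a * b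
  ∣∣≤-* {x} {y} {a} {b} (l , u) (l′ , u′) =
    0≤x+x⇒0≤x (subst (0ᵣ ≤ᵣ_)
      (solve 4 (λ x y a b → (a :- x) :* (b :+ y) :+ (a :+ x) :* (b :- y) :=
        (a :* b :- x :* y) :+ (a :* b :- x :* y)) refl x y a b)
      (+-nonneg (*-nonneg l u′) (*-nonneg u l′))) ,
    0≤x+x⇒0≤x (subst (0ᵣ ≤ᵣ_)
      (solve 4 (λ x y a b → (a :- x) :* (b :- y) :+ (a :+ x) :* (b :+ y) :=
        (a :* b :+ x :* y) :+ (a :* b :+ x :* y)) refl x y a b)
      (+-nonneg (*-nonneg l l′) (*-nonneg u u′)))

  ∣∣≤-weaken : ∀ {x a b} → 0ᵣ ≤ᵣ b - a → ∣ x ∣≤ a → ∣ x ∣≤ b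
  ∣∣≤-weaken {x} {a} {b} a≤b (l , u) =
    subst (0ᵣ ≤ᵣ_) (solve 3 (λ x a b → b :- a :+ (a :- x) := b :- x) refl x a b) (+-nonneg a≤b l) ,
    subst (0ᵣ ≤ᵣ_) (solve 3 (λ x a b → b :- a :+ (a :+ x) := b :+ x) refl x a b) (+-nonneg a≤b u)

  ∣∣≤-self : ∀ {x} → 0ᵣ ≤ᵣ x → ∣ x ∣≤ x
  ∣∣≤-self {x} 0≤x = inj₂ (sym (-‿inverseʳ x)) , +-nonneg 0≤x 0≤x

  magnitude : ∀ x → ∃ (∣ x ∣≤_)
  magnitude x with <-trichotomy 0ᵣ x
  ... | inj₁ 0<x = x , ∣∣≤-self (inj₁ 0<x)
  ... | inj₂ (inj₁ 0≡x) = x , ∣∣≤-self (inj₂ 0≡x)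
  ... | inj₂ (inj₂ x<0) = - x ,
    subst (∣_∣≤ - x) (-‿involutive x) (∣∣≤-neg (∣∣≤-self (inj₁ (neg-pos x<0))))

  minimum : ∀ {x y} → 0ᵣ <ᵣ x → 0ᵣ <ᵣ y → ∃ λ m → 0ᵣ <ᵣ m × 0ᵣ ≤ᵣ x - m × 0ᵣ ≤ᵣ y - m
  minimum {x} {y} 0<x 0<y with <-trichotomy x y
  ... | inj₁ x<y = x , 0<x , ≤⇒0≤- (inj₂ refl) , ≤⇒0≤- (inj₁ x<y)
  ... | inj₂ (inj₁ refl) = x , 0<x , ≤⇒0≤- (inj₂ refl) , ≤⇒0≤- (inj₂ refl)
  ... | inj₂ (inj₂ y<x) = y , 0<y , ≤⇒0≤- (inj₁ y<x) , ≤⇒0≤- (inj₂ refl)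

-- Persistence of positivity near a point.

module LocalSigns (R : RealField) where
  open OrderedField R

  -- Continuity at y with a linear modulus for steps of size at most 1. Explicit constants make the
  -- property easy to carry through the recurrence that defines `u`.
  LipschitzAt : (ℝ → ℝ) → ℝ → Set
  LipschitzAt f y = ∃ λ M → 0ᵣ ≤ᵣ M ×
    (∀ d h → 0ᵣ ≤ᵣ 1ᵣ - d → ∣ h ∣≤ d → ∣ f (y + h) - f y ∣≤ M * d)

  lipschitz-const : ∀ c y → LipschitzAt (λ _ → c) y
  lipschitz-const c y = 0ᵣ , inj₂ refl , λ d h d≤1 ∣h∣≤d →
    subst₂ ∣_∣≤_ (sym (-‿inverseʳ c)) (sym (zeroˡ d)) (∣∣≤-self (inj₂ refl))

  lipschitz-neg : ∀ f {y} → LipschitzAt f y → LipschitzAt (λ z → - f z) y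
  lipschitz-neg f {y} (M , 0≤M , bound) = M , 0≤M , λ d h d≤1 ∣h∣≤d →
    subst (∣_∣≤ M * d) (sym (-‿+-comm (f (y + h)) (- f y))) (∣∣≤-neg (bound d h d≤1 ∣h∣≤d))

  lipschitz-+ : ∀ f g {y} → LipschitzAt f y → LipschitzAt g y → LipschitzAt (λ z → f z + g z) y
  lipschitz-+ f g {y} (M , 0≤M , bound) (M′ , 0≤M′ , bound′) =
    M + M′ , +-nonneg 0≤M 0≤M′ , λ d h d≤1 ∣h∣≤d → subst₂ ∣_∣≤_
      (solve 4 (λ a b c e → a :- b :+ (c :- e) := a :+ c :- (b :+ e)) refl
        (f (y + h)) (f y) (g (y + h)) (g y))
      (sym (distribʳ d M M′))
      (∣∣≤-+ (bound d h d≤1 ∣h∣≤d) (bound′ d h d≤1 ∣h∣≤d))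

  -- With Δ = f (y + h) - f y, the change of z * f z is yΔ + h f y + hΔ; the restriction d ≤ 1 keeps
  -- the last term linear in d.
  lipschitz-id* : ∀ f {y} → LipschitzAt f y → LipschitzAt (λ z → z * f z) y
  lipschitz-id* f {y} (M , 0≤M , bound) with magnitude y | magnitude (f y)
  ... | B , ∣y∣≤B | U , ∣fy∣≤U =
    B * M + (U + M) ,
    +-nonneg (*-nonneg (∣∣≤⇒0≤ ∣y∣≤B) 0≤M) (+-nonneg (∣∣≤⇒0≤ ∣fy∣≤U) 0≤M) ,
    λ d h d≤1 ∣h∣≤d → subst₂ ∣_∣≤_
      (solve 4 (λ y h a b → y :* (a :- b) :+ (h :* b :+ h :* (a :- b)) := (y :+ h) :* a :- y :* b)
        refl y h (f (y + h)) (f y))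
      (trans (cong (λ z → B * (M * d) + (d * U + z)) (*-identityˡ (M * d)))
        (solve 4 (λ B M U d → B :* (M :* d) :+ (d :* U :+ M :* d) := (B :* M :+ (U :+ M)) :* d)
          refl B M U d))
      (∣∣≤-+ (∣∣≤-* ∣y∣≤B (bound d h d≤1 ∣h∣≤d))
        (∣∣≤-+ (∣∣≤-* ∣h∣≤d ∣fy∣≤U) (∣∣≤-* (∣∣≤-weaken d≤1 ∣h∣≤d) (bound d h d≤1 ∣h∣≤d))))

  PositiveNear : (ℝ → ℝ) → ℝ → Set
  PositiveNear f y = ∃ λ δ → 0ᵣ <ᵣ δ × (∀ h → ∣ h ∣≤ δ → 0ᵣ <ᵣ f (y + h))

  -- Take δ to be the smaller of 1 and ε = f y / (1 + M). The value drops by at most Mδ, which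
  -- leaves at least (1 + M)ε - Mδ ≥ δ > 0.
  positive⇒positiveNear : ∀ f {y} → LipschitzAt f y → 0ᵣ <ᵣ f y → PositiveNear f y
  positive⇒positiveNear f {y} (M , 0≤M , bound) 0<fy
    with inv (1ᵣ + M) (0<⇒≢0 (+-pos-nonneg 0<1 0≤M))
  ... | i , [1+M]i≡1
    with minimum 0<1 0<ε
    where
    0<ε : 0ᵣ <ᵣ i * f y
    0<ε = *-pos (0<x*y⇒0<y (+-pos-nonneg 0<1 0≤M) (subst (0ᵣ <ᵣ_) (sym [1+M]i≡1) 0<1)) 0<fy
  ... | δ , 0<δ , δ≤1 , δ≤ε = δ , 0<δ , λ h ∣h∣≤δ → subst (0ᵣ <ᵣ_) (split h)
      (+-pos-nonneg (+-pos-nonneg 0<δ (+-nonneg δ≤ε (*-nonneg 0≤M δ≤ε)))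
        (proj₂ (bound δ h δ≤1 ∣h∣≤δ)))
    where
    open ≡-Reasoning
    ε = i * f y
    [1+M]ε≡fy : (1ᵣ + M) * ε ≡ f y
    [1+M]ε≡fy = trans (sym (*-assoc (1ᵣ + M) i (f y)))
      (trans (cong (_* f y) [1+M]i≡1) (*-identityˡ (f y)))
    split : ∀ h → δ + (ε - δ + M * (ε - δ)) + (M * δ + (f (y + h) - f y)) ≡ f (y + h)
    split h = begin
      δ + (ε - δ + M * (ε - δ)) + (M * δ + (f (y + h) - f y))
        ≡⟨ solve 5 (λ δ ε M a b → δ :+ (ε :- δ :+ M :* (ε :- δ)) :+ (M :* δ :+ (a :- b))
             := (con (pos 1) :+ M) :* ε :+ (a :- b)) refl δ ε M (f (y + h)) (f y) ⟩
      (1ᵣ + M) * ε + (f (y + h) - f y)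
        ≡⟨ cong (_+ (f (y + h) - f y)) [1+M]ε≡fy ⟩
      f y + (f (y + h) - f y)
        ≡⟨ solve 2 (λ a b → b :+ (a :- b) := a) refl (f (y + h)) (f y) ⟩
      f (y + h) ∎

  family-positiveNear : (f : ℕ → ℝ → ℝ) (y : ℝ) (K : ℕ) → (∀ k → LipschitzAt (f k) y) →
    (∀ k → k ℕ.< K → 0ᵣ <ᵣ f k y) →
    ∃ λ δ → 0ᵣ <ᵣ δ × (∀ h → ∣ h ∣≤ δ → ∀ k → k ℕ.< K → 0ᵣ <ᵣ f k (y + h))
  family-positiveNear f y zero lip 0<f = 1ᵣ , 0<1 , λ _ _ _ ()
  family-positiveNear f y (suc K) lip 0<f = extend
    (family-positiveNear f y K lip (λ k k<K → 0<f k (ℕ.m<n⇒m<1+n k<K)))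
    (positive⇒positiveNear (f K) (lip K) (0<f K ℕ.≤-refl))
    where
    extend : (∃ λ δ → 0ᵣ <ᵣ δ × (∀ h → ∣ h ∣≤ δ → ∀ k → k ℕ.< K → 0ᵣ <ᵣ f k (y + h))) →
      PositiveNear (f K) y →
      ∃ λ δ → 0ᵣ <ᵣ δ × (∀ h → ∣ h ∣≤ δ → ∀ k → k ℕ.< suc K → 0ᵣ <ᵣ f k (y + h))
    extend (δ₁ , 0<δ₁ , near₁) (δ₂ , 0<δ₂ , near₂) with minimum 0<δ₁ 0<δ₂
    ... | δ , 0<δ , δ≤δ₁ , δ≤δ₂ = δ , 0<δ , near
      where
      near : ∀ h → ∣ h ∣≤ δ → ∀ k → k ℕ.< suc K → 0ᵣ <ᵣ f k (y + h)
      near h ∣h∣≤δ k k<1+K with ℕ.m≤n⇒m<n∨m≡n (ℕ.≤-pred k<1+K)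
      ... | inj₁ k<K = near₁ h (∣∣≤-weaken δ≤δ₁ ∣h∣≤δ) k k<K
      ... | inj₂ refl = near₂ h (∣∣≤-weaken δ≤δ₂ ∣h∣≤δ)

-- Chebyshev polynomials and the construction of 2 cos (π / N).

module Chebyshev (R : RealField) where
  open OrderedField R
  open LocalSigns R

  -- With y = 2 cos θ this is sin (kθ) / sin θ.
  u : ℝ → ℕ → ℝ
  u y zero = 0ᵣ
  u y (suc zero) = 1ᵣ
  u y (suc (suc k)) = y * u y (suc k) - u y k

  -- The form p² - ypq + q² is invariant under the step (p, q) ↦ (q, yq - p) of the recurrence, and
  -- it is 1 at the start (0, 1).
  u-norm : ∀ y k → u y k * u y k + u y (suc k) * u y (suc k) - y * u y k * u y (suc k) ≡ 1ᵣ
  u-norm y zero = trans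
    (solve 2 (λ y o → con (pos 0) :* con (pos 0) :+ o :* o :- y :* con (pos 0) :* o := o :* o) refl y 1ᵣ)
    (*-identityˡ 1ᵣ)
  u-norm y (suc k) = trans
    (solve 3 (λ y p q → q :* q :+ (y :* q :- p) :* (y :* q :- p) :- y :* q :* (y :* q :- p)
      := p :* p :+ q :* q :- y :* p :* q) refl y (u y k) (u y (suc k)))
    (u-norm y k)

  -- Each difference is the preceding one plus (y - 2) times a positive term. This is what bounds
  -- the set `NonPositive N` by 2.
  u-increasing : ∀ {y} → 2ᵣ <ᵣ y → ∀ k → 0ᵣ ≤ᵣ u y k × 0ᵣ <ᵣ u y (suc k) - u y k
  u-increasing 2<y zero = inj₂ refl ,
    subst (0ᵣ <ᵣ_) (solve 1 (λ o → o := o :- con (pos 0)) refl 1ᵣ) 0<1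
  u-increasing {y} 2<y (suc k) with u-increasing 2<y k
  ... | 0≤uₖ , 0<Δ = inj₁ 0<uₖ₊₁ , subst (0ᵣ <ᵣ_)
    (solve 3 (λ y p q → q :- p :+ (y :- con (pos 2)) :* q := y :* q :- p :- q) refl
      y (u y k) (u y (suc k)))
    (+-pos-nonneg 0<Δ (inj₁ (*-pos (<⇒0<- 2<y) 0<uₖ₊₁)))
    where
    0<uₖ₊₁ : 0ᵣ <ᵣ u y (suc k)
    0<uₖ₊₁ = subst (0ᵣ <ᵣ_) (solve 2 (λ p q → q :- p :+ p := q) refl (u y k) (u y (suc k)))
      (+-pos-nonneg 0<Δ 0≤uₖ)

  u-lipschitz : ∀ y k → LipschitzAt (λ z → u z k) y
  u-lipschitz y zero = lipschitz-const 0ᵣ y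
  u-lipschitz y (suc zero) = lipschitz-const 1ᵣ y
  u-lipschitz y (suc (suc k)) =
    lipschitz-+ (λ z → z * u z (suc k)) (λ z → - u z k)
      (lipschitz-id* (λ z → u z (suc k)) (u-lipschitz y (suc k)))
      (lipschitz-neg (λ z → u z k) (u-lipschitz y k))

  -- Two consecutive zeros would make the invariant of `u-norm` equal to 0 instead of 1.
  u-nonzero-next : ∀ y k → u y k ≡ 0ᵣ → ¬ u y (suc k) ≡ 0ᵣ
  u-nonzero-next y k uₖ≡0 uₖ₊₁≡0 = 0≢1 (begin
    0ᵣ
      ≡⟨ solve 1 (λ y → con (pos 0) := o :* o :+ o :* o :- y :* o :* o) refl y ⟩
    0ᵣ * 0ᵣ + 0ᵣ * 0ᵣ - y * 0ᵣ * 0ᵣ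
      ≡⟨ cong₂ (λ p q → p * p + q * q - y * p * q) uₖ≡0 uₖ₊₁≡0 ⟨
    u y k * u y k + u y (suc k) * u y (suc k) - y * u y k * u y (suc k)
      ≡⟨ u-norm y k ⟩
    1ᵣ ∎)
    where
    open ≡-Reasoning
    o : ∀ {n} → Polynomial n
    o = con (pos 0)

  -- The indices run over 1, ..., N: the shift by `suc` leaves out `u y 0`, which is 0 for every y.
  NonPositive : ℕ → ℝ → Set
  NonPositive N y = ∃ λ k → k ℕ.< N × u y (suc k) ≤ᵣ 0ᵣ

  2-upperBound : ∀ N → UpperBound (NonPositive N) 2ᵣ
  2-upperBound N y (k , _ , u≤0) = ≮⇒≥ λ 2<y → <⇒≱
    (subst (0ᵣ <ᵣ_) (solve 2 (λ p q → q :- p :+ p := q) refl (u y k) (u y (suc k)))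
      (+-pos-nonneg (proj₂ (u-increasing 2<y k)) (proj₁ (u-increasing 2<y k)))) u≤0

  0-nonPositive : ∀ {N} → 2 ℕ.≤ N → NonPositive N 0ᵣ
  -- The second polynomial is y itself, which vanishes at 0.
  0-nonPositive 2≤N = 1 , 2≤N ,
    inj₂ (solve 1 (λ o → con (pos 0) :* o :- con (pos 0) := con (pos 0)) refl 1ᵣ)

  -- The least upper bound s is 2 cos (π / N).  If u s k vanished for some 0 < k < N, its
  -- neighbours, which are nonnegative by continuity, would be opposite and hence both zero.
  module LeastUpperBound (N : ℕ) (s : ℝ) (upperBound : UpperBound (NonPositive N) s)
    (least : ∀ b → UpperBound (NonPositive N) b → s ≤ᵣ b) where

    above : ∀ y → s <ᵣ y → ∀ k → k ℕ.< N → 0ᵣ <ᵣ u y (suc k)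
    above y s<y k k<N = ≰⇒> λ u≤0 → <⇒≱ s<y (upperBound y (k , k<N , u≤0))

    -- A negative value at s would persist at some s + δ, where `above` makes all these values
    -- positive.
    nonneg : ∀ k → k ℕ.≤ N → 0ᵣ ≤ᵣ u s k
    nonneg zero _ = inj₂ refl
    nonneg (suc k) k<N = ≮⇒≥ λ u<0 → contradict
      (positive⇒positiveNear (λ z → - u z (suc k))
        (lipschitz-neg (λ z → u z (suc k)) (u-lipschitz s (suc k))) (neg-pos u<0))
      where
      contradict : ¬ PositiveNear (λ z → - u z (suc k)) s
      contradict (δ , 0<δ , near) = <⇒≱
        (above (s + δ) (0<-⇒< (subst (0ᵣ <ᵣ_) (solve 2 (λ s δ → δ := s :+ δ :- s) refl s δ) 0<δ)) k k<N)
        (inj₁ (neg-pos⁻¹ (near δ (∣∣≤-self (inj₁ 0<δ)))))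

    positive : ∀ k → 0 ℕ.< k → k ℕ.< N → 0ᵣ <ᵣ u s k
    positive (suc k) _ k<N = [ id , (λ 0≡uₖ₊₁ → ⊥-elim (absurd 0≡uₖ₊₁)) ]′
      (nonneg (suc k) (ℕ.<⇒≤ k<N))
      where
      absurd : ¬ 0ᵣ ≡ u s (suc k)
      absurd 0≡uₖ₊₁ = u-nonzero-next s k (sym 0≡uₖ) (sym 0≡uₖ₊₁)
        where
        uₖ₊₂≡-uₖ : u s (suc (suc k)) ≡ - u s k
        uₖ₊₂≡-uₖ = trans (cong (λ z → s * z - u s k) (sym 0≡uₖ₊₁))
          (solve 2 (λ s p → s :* con (pos 0) :- p := :- p) refl s (u s k))
        0≡uₖ : 0ᵣ ≡ u s k
        0≡uₖ = [ (λ 0<u → ⊥-elim (<⇒≱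
            (neg-pos⁻¹ (subst (0ᵣ <ᵣ_) (sym (-‿involutive (u s k))) 0<u))
            (subst (0ᵣ ≤ᵣ_) uₖ₊₂≡-uₖ (nonneg (suc (suc k)) k<N)))) , id ]′
          (nonneg k (ℕ.<⇒≤ (ℕ.<-trans (ℕ.n<1+n k) k<N)))

    -- Otherwise all N values stay positive within some δ of s, and s - δ would be a smaller upper
    -- bound. Together with `positive` this forces the zero at index N.
    not-all-positive : ¬ (∀ k → k ℕ.< N → 0ᵣ <ᵣ u s (suc k))
    not-all-positive 0<u = contradict
      (family-positiveNear (λ k z → u z (suc k)) s N (λ k → u-lipschitz s (suc k)) 0<u)
      where
      contradict : ¬ (∃ λ δ → 0ᵣ <ᵣ δ ×
        (∀ h → ∣ h ∣≤ δ → ∀ k → k ℕ.< N → 0ᵣ <ᵣ u (s + h) (suc k)))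
      contradict (δ , 0<δ , near) = <⇒≱
        (0<-⇒< (subst (0ᵣ <ᵣ_) (solve 2 (λ s δ → δ := s :- (s :- δ)) refl s δ) 0<δ))
        (least (s - δ) s-δ-upperBound)
        where
        s-δ-upperBound : UpperBound (NonPositive N) (s - δ)
        s-δ-upperBound y y∈P@(k , k<N , u≤0) = ≮⇒≥ λ s-δ<y → <⇒≱
          (subst (λ z → 0ᵣ <ᵣ u z (suc k)) (solve 2 (λ s y → s :+ (y :- s) := y) refl s y)
            (near (y - s)
              ( subst (0ᵣ ≤ᵣ_) (solve 3 (λ s δ y → δ :+ (s :- y) := δ :- (y :- s)) refl s δ y)
                  (+-nonneg (inj₁ 0<δ) (≤⇒0≤- (upperBound y y∈P)))
              , subst (0ᵣ ≤ᵣ_) (solve 3 (λ s δ y → y :- (s :- δ) := δ :+ (y :- s)) refl s δ y)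
                  (inj₁ (<⇒0<- s-δ<y)))
              k k<N))
          u≤0

    zero-N : u s N ≡ 0ᵣ
    zero-N = [ (λ 0<uN → ⊥-elim (not-all-positive (λ k k<N →
        [ positive (suc k) (s≤s z≤n) , (λ { refl → 0<uN }) ]′ (ℕ.m≤n⇒m<n∨m≡n k<N)))) , sym ]′
      (nonneg N ℕ.≤-refl)

  u-root : ∀ N → 2 ℕ.≤ N →
    ∃ λ y → u y N ≡ 0ᵣ × (∀ k → 0 ℕ.< k → k ℕ.< N → 0ᵣ <ᵣ u y k)
  u-root N 2≤N =
    let s , upperBound , least = sup (NonPositive N) (0ᵣ , 0-nonPositive 2≤N) (2ᵣ , 2-upperBound N)
        open LeastUpperBound N s upperBound least
    in s , zero-N , positive

-- Collinearity through homogeneous determinants.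

module Collinearity (R : RealField) where
  open OrderedField R
  open Plane R hiding (_-ᵣ_)

  det : (w₁ x₁ z₁ w₂ x₂ z₂ w₃ x₃ z₃ : ℝ) → ℝ
  det w₁ x₁ z₁ w₂ x₂ z₂ w₃ x₃ z₃ =
    w₁ * (x₂ * z₃ - x₃ * z₂) + w₂ * (x₃ * z₁ - x₁ * z₃) + w₃ * (x₁ * z₂ - x₂ * z₁)

  det-affine : ∀ {w₁ i₁ w₂ i₂ w₃ i₃} x₁ z₁ x₂ z₂ x₃ z₃ →
    w₁ * i₁ ≡ 1ᵣ → w₂ * i₂ ≡ 1ᵣ → w₃ * i₃ ≡ 1ᵣ →
    (x₂ * i₂ - x₁ * i₁) * (z₃ * i₃ - z₁ * i₁) - (z₂ * i₂ - z₁ * i₁) * (x₃ * i₃ - x₁ * i₁) ≡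
    i₁ * i₂ * i₃ * det w₁ x₁ z₁ w₂ x₂ z₂ w₃ x₃ z₃
  det-affine {w₁} {i₁} {w₂} {i₂} {w₃} {i₃} x₁ z₁ x₂ z₂ x₃ z₃ w₁i₁≡1 w₂i₂≡1 w₃i₃≡1 = begin
    (x₂ * i₂ - x₁ * i₁) * (z₃ * i₃ - z₁ * i₁) - (z₂ * i₂ - z₁ * i₁) * (x₃ * i₃ - x₁ * i₁)
      ≡⟨ cong₂ _-_
           (cong₂ _*_ (common x₁ x₂ w₁i₁≡1 w₂i₂≡1) (common z₁ z₃ w₁i₁≡1 w₃i₃≡1))
           (cong₂ _*_ (common z₁ z₂ w₁i₁≡1 w₂i₂≡1) (common x₁ x₃ w₁i₁≡1 w₃i₃≡1)) ⟩
    i₁ * i₂ * (x₂ * w₁ - x₁ * w₂) * (i₁ * i₃ * (z₃ * w₁ - z₁ * w₃)) -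
    i₁ * i₂ * (z₂ * w₁ - z₁ * w₂) * (i₁ * i₃ * (x₃ * w₁ - x₁ * w₃))
      -- Over common denominators i₁ occurs twice; the surplus i₁ pairs with the factor w₁ that
      -- splits off, and w₁ * i₁ is 1.
      ≡⟨ solve 12 (λ w₁ i₁ w₂ i₂ w₃ i₃ x₁ z₁ x₂ z₂ x₃ z₃ →
           i₁ :* i₂ :* (x₂ :* w₁ :- x₁ :* w₂) :* (i₁ :* i₃ :* (z₃ :* w₁ :- z₁ :* w₃)) :-
           i₁ :* i₂ :* (z₂ :* w₁ :- z₁ :* w₂) :* (i₁ :* i₃ :* (x₃ :* w₁ :- x₁ :* w₃)) :=
           w₁ :* i₁ :* (i₁ :* i₂ :* i₃ :* (w₁ :* (x₂ :* z₃ :- x₃ :* z₂) :+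
             w₂ :* (x₃ :* z₁ :- x₁ :* z₃) :+ w₃ :* (x₁ :* z₂ :- x₂ :* z₁))))
         refl w₁ i₁ w₂ i₂ w₃ i₃ x₁ z₁ x₂ z₂ x₃ z₃ ⟩
    w₁ * i₁ * (i₁ * i₂ * i₃ * det w₁ x₁ z₁ w₂ x₂ z₂ w₃ x₃ z₃)
      ≡⟨ cong (_* (i₁ * i₂ * i₃ * det w₁ x₁ z₁ w₂ x₂ z₂ w₃ x₃ z₃)) w₁i₁≡1 ⟩
    1ᵣ * (i₁ * i₂ * i₃ * det w₁ x₁ z₁ w₂ x₂ z₂ w₃ x₃ z₃)
      ≡⟨ *-identityˡ _ ⟩
    i₁ * i₂ * i₃ * det w₁ x₁ z₁ w₂ x₂ z₂ w₃ x₃ z₃ ∎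
    where
    open ≡-Reasoning
    common : ∀ {w i w′ i′} x x′ → w * i ≡ 1ᵣ → w′ * i′ ≡ 1ᵣ →
      x′ * i′ - x * i ≡ i * i′ * (x′ * w - x * w′)
    common {w} {i} {w′} {i′} x x′ wi≡1 w′i′≡1 = begin
      x′ * i′ - x * i
        ≡⟨ cong₂ _-_ (*-identityˡ (x′ * i′)) (*-identityˡ (x * i)) ⟨
      1ᵣ * (x′ * i′) - 1ᵣ * (x * i)
        ≡⟨ cong₂ (λ a b → a * (x′ * i′) - b * (x * i)) wi≡1 w′i′≡1 ⟨
      w * i * (x′ * i′) - w′ * i′ * (x * i)
        ≡⟨ solve 6 (λ w i w′ i′ x x′ → w :* i :* (x′ :* i′) :- w′ :* i′ :* (x :* i) :=
             i :* i′ :* (x′ :* w :- x :* w′)) refl w i w′ i′ x x′ ⟩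
      i * i′ * (x′ * w - x * w′) ∎

  -- Both a and b times the determinant E are combinations of differences of the line equation at
  -- the three points, hence 0, and one of a, b is invertible.
  ∈ₗ⇒collinear : ∀ {P Q S} L → P ∈ₗ L → Q ∈ₗ L → S ∈ₗ L → Collinear P Q S
  ∈ₗ⇒collinear {px , py} {qx , qy} {sx , sy} L P∈L Q∈L S∈L = x-y≡0⇒x≡y E≡0
    where
    open Line L
    open ≡-Reasoning
    E = (qx - px) * (sy - py) - (qy - py) * (sx - px)
    E-combination : ∀ k l {x y z} → x ≡ c → y ≡ c → z ≡ c → k * (y - x) - l * (z - x) ≡ 0ᵣ
    E-combination k l refl refl refl =
      solve 3 (λ k l c → k :* (c :- c) :- l :* (c :- c) := con (pos 0)) refl k l c
    aE≡0 : a * E ≡ 0ᵣ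
    aE≡0 = trans
      (solve 8 (λ a b px py qx qy sx sy →
        a :* ((qx :- px) :* (sy :- py) :- (qy :- py) :* (sx :- px)) :=
        (sy :- py) :* ((a :* qx :+ b :* qy) :- (a :* px :+ b :* py)) :-
        (qy :- py) :* ((a :* sx :+ b :* sy) :- (a :* px :+ b :* py))) refl a b px py qx qy sx sy)
      (E-combination (sy - py) (qy - py) P∈L Q∈L S∈L)
    bE≡0 : b * E ≡ 0ᵣ
    bE≡0 = trans
      (solve 8 (λ a b px py qx qy sx sy →
        b :* ((qx :- px) :* (sy :- py) :- (qy :- py) :* (sx :- px)) :=
        (qx :- px) :* ((a :* sx :+ b :* sy) :- (a :* px :+ b :* py)) :-
        (sx :- px) :* ((a :* qx :+ b :* qy) :- (a :* px :+ b :* py))) refl a b px py qx qy sx sy)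
      (E-combination (qx - px) (sx - px) P∈L S∈L Q∈L)
    E≡0 : E ≡ 0ᵣ
    E≡0 with a ≟ᵣ 0ᵣ
    ... | no a≢0 = x*y≡0⇒y≡0 a≢0 aE≡0
    ... | yes a≡0 = x*y≡0⇒y≡0 (λ b≡0 → nondeg (a≡0 , b≡0)) bE≡0

-- The cyclic group of order N on the cubic.

module TorsionPoints (R : RealField) (y : RealField.ℝ R) (N : ℕ) {{_ : ℕ.NonZero N}}
  (u-N : Chebyshev.u R y N ≡ RealField.0ᵣ R)
  (u-positive : ∀ k → 0 ℕ.< k → k ℕ.< N → RealField._<ᵣ_ R (RealField.0ᵣ R) (Chebyshev.u R y k))
  where
  open OrderedField R
  open Plane R hiding (_-ᵣ_)
  open Chebyshev R using (u-norm; u-nonzero-next)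
  open Collinearity R

  u : ℕ → ℝ
  u = Chebyshev.u R y

  -- The addition theorem for the sine, with cosines eliminated in favour of consecutive terms. The
  -- induction needs both formulas at once.
  u-+ : ∀ a b →
    u (a ℕ.+ b) ≡ u a * u (suc b) + u (suc a) * u b - y * u a * u b ×
    u (suc (a ℕ.+ b)) ≡ u (suc a) * u (suc b) - u a * u b
  u-+ zero b =
    solve 3 (λ y p q → p := con (pos 0) :* q :+ con (pos 1) :* p :- y :* con (pos 0) :* p)
      refl y (u b) (u (suc b)) ,
    solve 2 (λ p q → q := con (pos 1) :* q :- con (pos 0) :* p) refl (u b) (u (suc b))
  u-+ (suc a) b with u-+ a b
  ... | u[a+b] , u[1+a+b] =
    trans u[1+a+b] (solve 5 (λ y pa qa pb qb → qa :* qb :- pa :* pb :=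
        qa :* qb :+ (y :* qa :- pa) :* pb :- y :* qa :* pb) refl y (u a) (u (suc a)) (u b) (u (suc b))) ,
    trans (cong₂ (λ q p → y * q - p) u[1+a+b] u[a+b])
      (solve 5 (λ y pa qa pb qb →
        y :* (qa :* qb :- pa :* pb) :- (pa :* qb :+ qa :* pb :- y :* pa :* pb) :=
        (y :* qa :- pa) :* qb :- qa :* pb) refl y (u a) (u (suc a)) (u b) (u (suc b)))

  u-*N : ∀ q → u (q ℕ.* N) ≡ 0ᵣ
  u-*N zero = refl
  u-*N (suc q) = begin
    u (N ℕ.+ q ℕ.* N)
      ≡⟨ proj₁ (u-+ N (q ℕ.* N)) ⟩
    u N * b + a * u (q ℕ.* N) - y * u N * u (q ℕ.* N)
      ≡⟨ cong₂ (λ p p′ → p * b + a * p′ - y * p * p′) u-N (u-*N q) ⟩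
    0ᵣ * b + a * 0ᵣ - y * 0ᵣ * 0ᵣ
      ≡⟨ solve 3 (λ y a b → con (pos 0) :* b :+ a :* con (pos 0) :- y :* con (pos 0) :* con (pos 0)
           := con (pos 0)) refl y a b ⟩
    0ᵣ ∎
    where
    open ≡-Reasoning
    a = u (suc N)
    b = u (suc (q ℕ.* N))

  ∣⇒u≡0 : ∀ {k} → N ∣ k → u k ≡ 0ᵣ
  ∣⇒u≡0 (divides q refl) = u-*N q

  -- Write k = r + qN with r < N. Since `u (q * N)` is 0, the addition formula reduces to u k = u r
  -- · u (qN + 1) with nonzero second factor, and u r > 0 unless r = 0.
  u≡0⇒∣ : ∀ {k} → u k ≡ 0ᵣ → N ∣ k
  u≡0⇒∣ {k} uk≡0 = m%n≡0⇒n∣m k N (r≡0 (k ℕ.% N) (m%n<n k N) ur≡0)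
    where
    open ≡-Reasoning
    r = k ℕ.% N
    qN = k ℕ./ N ℕ.* N
    ur≡0 : u r ≡ 0ᵣ
    ur≡0 = x*y≡0⇒y≡0 (u-nonzero-next y qN (u-*N (k ℕ./ N))) (begin
      u (suc qN) * u r
        ≡⟨ solve 4 (λ y p q p′ → q :* p := p :* q :+ p′ :* con (pos 0) :- y :* p :* con (pos 0))
             refl y (u r) (u (suc qN)) (u (suc r)) ⟩
      u r * u (suc qN) + u (suc r) * 0ᵣ - y * u r * 0ᵣ
        ≡⟨ cong (λ z → u r * u (suc qN) + u (suc r) * z - y * u r * z) (u-*N (k ℕ./ N)) ⟨
      u r * u (suc qN) + u (suc r) * u qN - y * u r * u qN
        ≡⟨ proj₁ (u-+ r qN) ⟨
      u (r ℕ.+ qN)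
        ≡⟨ cong u (m≡m%n+[m/n]*n k N) ⟨
      u k
        ≡⟨ uk≡0 ⟩
      0ᵣ ∎)
    r≡0 : ∀ r → r ℕ.< N → u r ≡ 0ᵣ → r ≡ 0
    r≡0 zero _ _ = refl
    r≡0 (suc r) r<N ur≡0 = ⊥-elim (0<⇒≢0 (u-positive (suc r) (s≤s z≤n) r<N) ur≡0)

  -- This is sin ((a - b)θ) / sin θ, expressed without subtracting indices.
  cross : ℕ → ℕ → ℝ
  cross a b = u a * u (suc b) - u (suc a) * u b

  cross-+ : ∀ b d → cross (b ℕ.+ d) b ≡ u d
  cross-+ b d = begin
    cross (b ℕ.+ d) b
      ≡⟨ cong₂ (λ p q → p * u (suc b) - q * u b) (proj₁ (u-+ b d)) (proj₂ (u-+ b d)) ⟩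
    (pb * qd + qb * pd - y * pb * pd) * qb - (qb * qd - pb * pd) * pb
      ≡⟨ solve 5 (λ y pb qb pd qd →
           (pb :* qd :+ qb :* pd :- y :* pb :* pd) :* qb :- (qb :* qd :- pb :* pd) :* pb :=
           (pb :* pb :+ qb :* qb :- y :* pb :* qb) :* pd) refl y pb qb pd qd ⟩
    (pb * pb + qb * qb - y * pb * qb) * pd
      ≡⟨ cong (_* pd) (u-norm y b) ⟩
    1ᵣ * pd
      ≡⟨ *-identityˡ pd ⟩
    u d ∎
    where
    open ≡-Reasoning
    pb = u b
    qb = u (suc b)
    pd = u d
    qd = u (suc d)

  cross-neg : ∀ a b → - cross a b ≡ cross b a
  cross-neg a b = solve 4 (λ pa qa pb qb → :- (pa :* qb :- qa :* pb) := pb :* qa :- qb :* pa)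
    refl (u a) (u (suc a)) (u b) (u (suc b))

  cross>0 : ∀ {a b} → a ℕ.< N → b ℕ.< a → 0ᵣ <ᵣ cross a b
  cross>0 {a} {b} a<N b<a = subst (λ z → 0ᵣ <ᵣ cross z b) (ℕ.m+[n∸m]≡n (ℕ.<⇒≤ b<a))
    (subst (0ᵣ <ᵣ_) (sym (cross-+ b (a ℕ.∸ b)))
      (u-positive (a ℕ.∸ b) (ℕ.m<n⇒0<n∸m b<a) (ℕ.≤-<-trans (ℕ.m∸n≤m a b) a<N)))

  cross≢0 : ∀ {a b} → a ℕ.< N → b ℕ.< N → ¬ a ≡ b → ¬ cross a b ≡ 0ᵣ
  cross≢0 {a} {b} a<N b<N a≢b cross≡0 with ℕ.<-cmp a b
  ... | tri> _ _ b<a = 0<⇒≢0 (cross>0 a<N b<a) cross≡0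
  ... | tri≈ _ a≡b _ = a≢b a≡b
  ... | tri< a<b _ _ = 0<⇒≢0 (cross>0 b<N a<b)
    (trans (sym (cross-neg a b)) (trans (cong -_ cross≡0) -0#≈0#))

  weight : ℕ → ℝ
  weight a = u a + u (suc a)

  -- Only the end values `u 0` and `u N` vanish, so a zero summand, at a = 0 or a = N - 1, leaves
  -- the other one positive.
  weight>0 : ∀ a → a ℕ.< N → 0ᵣ <ᵣ weight a
  weight>0 zero _ = subst (0ᵣ <ᵣ_) (sym (+-identityˡ 1ᵣ)) 0<1
  weight>0 (suc a) 1+a<N = +-pos-nonneg (u-positive (suc a) (s≤s z≤n) 1+a<N)
    ([ (λ 2+a<N → inj₁ (u-positive (suc (suc a)) (s≤s z≤n) 2+a<N))
     , (λ 2+a≡N → inj₂ (sym (trans (cong u 2+a≡N) u-N))) ]′ (ℕ.m≤n⇒m<n∨m≡n 1+a<N))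

  -- The default value 0 makes the reciprocal total, so `pt` needs no bound on its argument.
  recip : ℝ → ℝ
  recip x with x ≟ᵣ 0ᵣ
  ... | yes _ = 0ᵣ
  ... | no x≢0 = proj₁ (inv x x≢0)

  *-recip : ∀ {x} → ¬ x ≡ 0ᵣ → x * recip x ≡ 1ᵣ
  *-recip {x} x≢0 with x ≟ᵣ 0ᵣ
  ... | yes x≡0 = ⊥-elim (x≢0 x≡0)
  ... | no x≢0 = proj₂ (inv x x≢0)

  recip≢0 : ∀ {x} → ¬ x ≡ 0ᵣ → ¬ recip x ≡ 0ᵣ
  recip≢0 {x} x≢0 recip≡0 = 0≢1 (trans (sym (zeroʳ x)) (trans (cong (x *_) (sym recip≡0)) (*-recip x≢0)))

  cube : ℝ → ℝ
  cube x = x * x * x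

  -- In homogeneous coordinates (q : p : p³), with p = sin aθ / sin θ and q = sin (a+1)θ / sin θ;
  -- the line p + q = 0, which contains none of the points with a < N, is sent to infinity.
  pt : ℕ → Point
  pt a = u a * recip (weight a) , cube (u a) * recip (weight a)

  -- The first coordinate p / (p + q) alone suffices: after cross-multiplication, the difference of
  -- two of these is `cross a b`.
  pt-injective : ∀ {a b} → a ℕ.< N → b ℕ.< N → pt a ≡ pt b → a ≡ b
  pt-injective {a} {b} a<N b<N eq with a ℕ.≟ b
  ... | yes a≡b = a≡b
  ... | no a≢b = ⊥-elim (cross≢0 a<N b<N a≢b (begin
      cross a b
        ≡⟨ solve 4 (λ pa qa pb qb → pa :* qb :- qa :* pb :=
             pa :* (pb :+ qb) :* con (pos 1) :- pb :* (pa :+ qa) :* con (pos 1))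
             refl (u a) (u (suc a)) (u b) (u (suc b)) ⟩
      u a * weight b * 1ᵣ - u b * weight a * 1ᵣ
        ≡⟨ cong₂ (λ s t → u a * weight b * s - u b * weight a * t)
             (*-recip (0<⇒≢0 (weight>0 a a<N))) (*-recip (0<⇒≢0 (weight>0 b b<N))) ⟨
      u a * weight b * (weight a * ia) - u b * weight a * (weight b * ib)
        ≡⟨ solve 6 (λ pa pb wa wb ia ib →
             pa :* wb :* (wa :* ia) :- pb :* wa :* (wb :* ib) :=
             wa :* wb :* (pa :* ia :- pb :* ib)) refl (u a) (u b) (weight a) (weight b) ia ib ⟩
      weight a * weight b * (u a * ia - u b * ib)
        ≡⟨ cong (λ z → weight a * weight b * (z - u b * ib)) (cong proj₁ eq) ⟩
      weight a * weight b * (u b * ib - u b * ib)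
        ≡⟨ solve 2 (λ w x → w :* (x :- x) := con (pos 0)) refl (weight a * weight b) (u b * ib) ⟩
      0ᵣ ∎))
    where
    open ≡-Reasoning
    ia = recip (weight a)
    ib = recip (weight b)

  -- A column operation replaces p + q by q. The row (q, p, p³) is not homogeneous, so q and p are
  -- multiplied by the norm form, which is 1 here. All entries are then cubic forms, and the
  -- identity becomes a polynomial one in y and the six p's and q's; its last factor is the addition
  -- formula applied twice.
  det-cubic : ∀ a b c →
    det (weight a) (u a) (cube (u a)) (weight b) (u b) (cube (u b)) (weight c) (u c) (cube (u c)) ≡
    cross a b * cross b c * cross c a * u (a ℕ.+ b ℕ.+ c)
  det-cubic a b c = begin
    det (weight a) (u a) (cube (u a)) (weight b) (u b) (cube (u b)) (weight c) (u c) (cube (u c))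
      ≡⟨ solve 6 (λ p₁ q₁ p₂ q₂ p₃ q₃ →
           det′ (p₁ :+ q₁) p₁ (cube′ p₁) (p₂ :+ q₂) p₂ (cube′ p₂) (p₃ :+ q₃) p₃ (cube′ p₃) :=
           det′ (q₁ :* con (pos 1)) (p₁ :* con (pos 1)) (cube′ p₁)
                (q₂ :* con (pos 1)) (p₂ :* con (pos 1)) (cube′ p₂)
                (q₃ :* con (pos 1)) (p₃ :* con (pos 1)) (cube′ p₃))
         refl p₁ q₁ p₂ q₂ p₃ q₃ ⟩
    det (q₁ * 1ᵣ) (p₁ * 1ᵣ) (cube p₁) (q₂ * 1ᵣ) (p₂ * 1ᵣ) (cube p₂) (q₃ * 1ᵣ) (p₃ * 1ᵣ) (cube p₃)
      ≡⟨ cong₂ (λ n₁ n₂ → det (q₁ * n₁) (p₁ * n₁) (cube p₁) (q₂ * n₂) (p₂ * n₂) (cube p₂)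
           (q₃ * 1ᵣ) (p₃ * 1ᵣ) (cube p₃)) (u-norm y a) (u-norm y b) ⟨
    det (q₁ * n₁) (p₁ * n₁) (cube p₁) (q₂ * n₂) (p₂ * n₂) (cube p₂) (q₃ * 1ᵣ) (p₃ * 1ᵣ) (cube p₃)
      ≡⟨ cong (λ n₃ → det (q₁ * n₁) (p₁ * n₁) (cube p₁) (q₂ * n₂) (p₂ * n₂) (cube p₂)
           (q₃ * n₃) (p₃ * n₃) (cube p₃)) (u-norm y c) ⟨
    det (q₁ * n₁) (p₁ * n₁) (cube p₁) (q₂ * n₂) (p₂ * n₂) (cube p₂) (q₃ * n₃) (p₃ * n₃) (cube p₃)
      ≡⟨ solve 7 (λ y p₁ q₁ p₂ q₂ p₃ q₃ →
           let norm′ = λ p q → p :* p :+ q :* q :- y :* p :* q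
               cross′ = λ p q p′ q′ → p :* q′ :- q :* p′
               p₁₂ = p₁ :* q₂ :+ q₁ :* p₂ :- y :* p₁ :* p₂
               q₁₂ = q₁ :* q₂ :- p₁ :* p₂
           in det′ (q₁ :* norm′ p₁ q₁) (p₁ :* norm′ p₁ q₁) (cube′ p₁)
                   (q₂ :* norm′ p₂ q₂) (p₂ :* norm′ p₂ q₂) (cube′ p₂)
                   (q₃ :* norm′ p₃ q₃) (p₃ :* norm′ p₃ q₃) (cube′ p₃) :=
              cross′ p₁ q₁ p₂ q₂ :* cross′ p₂ q₂ p₃ q₃ :* cross′ p₃ q₃ p₁ q₁ :*
              (p₁₂ :* q₃ :+ q₁₂ :* p₃ :- y :* p₁₂ :* p₃))
         refl y p₁ q₁ p₂ q₂ p₃ q₃ ⟩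
    C * ((p₁ * q₂ + q₁ * p₂ - y * p₁ * p₂) * q₃ + (q₁ * q₂ - p₁ * p₂) * p₃ -
      y * (p₁ * q₂ + q₁ * p₂ - y * p₁ * p₂) * p₃)
      ≡⟨ cong₂ (λ p₁₂ q₁₂ → C * (p₁₂ * q₃ + q₁₂ * p₃ - y * p₁₂ * p₃))
           (proj₁ (u-+ a b)) (proj₂ (u-+ a b)) ⟨
    C * (u (a ℕ.+ b) * q₃ + u (suc (a ℕ.+ b)) * p₃ - y * u (a ℕ.+ b) * p₃)
      ≡⟨ cong (C *_) (proj₁ (u-+ (a ℕ.+ b) c)) ⟨
    C * u (a ℕ.+ b ℕ.+ c) ∎
    where
    open ≡-Reasoning
    C = cross a b * cross b c * cross c a
    p₁ = u a
    q₁ = u (suc a)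
    p₂ = u b
    q₂ = u (suc b)
    p₃ = u c
    q₃ = u (suc c)
    n₁ = p₁ * p₁ + q₁ * q₁ - y * p₁ * q₁
    n₂ = p₂ * p₂ + q₂ * q₂ - y * p₂ * q₂
    n₃ = p₃ * p₃ + q₃ * q₃ - y * p₃ * q₃
    cube′ : ∀ {n} → Polynomial n → Polynomial n
    cube′ x = x :* x :* x
    det′ : ∀ {n} (w₁ x₁ z₁ w₂ x₂ z₂ w₃ x₃ z₃ : Polynomial n) → Polynomial n
    det′ w₁ x₁ z₁ w₂ x₂ z₂ w₃ x₃ z₃ =
      w₁ :* (x₂ :* z₃ :- x₃ :* z₂) :+ w₂ :* (x₃ :* z₁ :- x₁ :* z₃) :+ w₃ :* (x₁ :* z₂ :- x₂ :* z₁)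

  collinear-defect : ∀ {a b c} → a ℕ.< N → b ℕ.< N → c ℕ.< N →
    let (ax , ay) = pt a
        (bx , by) = pt b
        (cx , cy) = pt c
    in (bx - ax) * (cy - ay) - (by - ay) * (cx - ax) ≡
       recip (weight a) * recip (weight b) * recip (weight c) *
       (cross a b * cross b c * cross c a * u (a ℕ.+ b ℕ.+ c))
  collinear-defect {a} {b} {c} a<N b<N c<N = trans
    (det-affine (u a) (cube (u a)) (u b) (cube (u b)) (u c) (cube (u c))
      (*-recip (0<⇒≢0 (weight>0 a a<N))) (*-recip (0<⇒≢0 (weight>0 b b<N)))
      (*-recip (0<⇒≢0 (weight>0 c c<N))))
    (cong (recip (weight a) * recip (weight b) * recip (weight c) *_) (det-cubic a b c))

  ∣⇒collinear : ∀ {a b c} → a ℕ.< N → b ℕ.< N → c ℕ.< N → N ∣ a ℕ.+ b ℕ.+ c →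
    Collinear (pt a) (pt b) (pt c)
  ∣⇒collinear {a} {b} {c} a<N b<N c<N N∣a+b+c = x-y≡0⇒x≡y (begin
    _                   ≡⟨ collinear-defect a<N b<N c<N ⟩
    I * (C * u (a ℕ.+ b ℕ.+ c)) ≡⟨ cong (λ z → I * (C * z)) (∣⇒u≡0 N∣a+b+c) ⟩
    I * (C * 0ᵣ)        ≡⟨ solve 2 (λ I C → I :* (C :* con (pos 0)) := con (pos 0)) refl I C ⟩
    0ᵣ                  ∎)
    where
    open ≡-Reasoning
    I = recip (weight a) * recip (weight b) * recip (weight c)
    C = cross a b * cross b c * cross c a

  -- For distinct parameters the reciprocals and the three `cross` factors are nonzero, so the
  -- vanishing determinant forces u (a + b + c) = 0.
  collinear⇒∣ : ∀ {a b c} → a ℕ.< N → b ℕ.< N → c ℕ.< N →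
    ¬ a ≡ b → ¬ b ≡ c → ¬ c ≡ a → Collinear (pt a) (pt b) (pt c) → N ∣ a ℕ.+ b ℕ.+ c
  collinear⇒∣ {a} {b} {c} a<N b<N c<N a≢b b≢c c≢a collinear = u≡0⇒∣
    (x*y≡0⇒y≡0
      (*-nonzero (*-nonzero (cross≢0 a<N b<N a≢b) (cross≢0 b<N c<N b≢c)) (cross≢0 c<N a<N c≢a))
      (x*y≡0⇒y≡0
        (*-nonzero (*-nonzero (recip-weight≢0 a a<N) (recip-weight≢0 b b<N)) (recip-weight≢0 c c<N))
        (trans (sym (collinear-defect a<N b<N c<N)) (x≡y⇒x-y≡0 collinear))))
    where
    recip-weight≢0 : ∀ a → a ℕ.< N → ¬ recip (weight a) ≡ 0ᵣ
    recip-weight≢0 a a<N = recip≢0 (0<⇒≢0 (weight>0 a a<N))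

  third-unique-≮ : ∀ s {c d} → d ℕ.< N → N ∣ s ℕ.+ c → N ∣ s ℕ.+ d → ¬ c ℕ.< d
  third-unique-≮ s {c} {d} d<N N∣s+c N∣s+d c<d = >⇒∤ {{ℕ.>-nonZero (ℕ.m<n⇒0<n∸m c<d)}}
    (ℕ.≤-<-trans (ℕ.m∸n≤m d c) d<N)
    (∣m+n∣m⇒∣n (subst (N ∣_) (trans (cong (s ℕ.+_) (sym (ℕ.m+[n∸m]≡n (ℕ.<⇒≤ c<d))))
      (sym (ℕ.+-assoc s c (d ℕ.∸ c)))) N∣s+d) N∣s+c)

  third-unique : ∀ s {c d} → c ℕ.< N → d ℕ.< N → N ∣ s ℕ.+ c → N ∣ s ℕ.+ d → c ≡ d
  third-unique s c<N d<N N∣s+c N∣s+d =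
    ℕ.≤-antisym (ℕ.≮⇒≥ (third-unique-≮ s c<N N∣s+d N∣s+c)) (ℕ.≮⇒≥ (third-unique-≮ s d<N N∣s+c N∣s+d))

-- Finite arithmetic: residues mod 7 and offsets.

open import Data.Nat using (_+_; _*_; _≤_)

∣m+n∣n⇒∣m : ∀ {d m n} → d ∣ m + n → d ∣ n → d ∣ m
∣m+n∣n⇒∣m {d} {m} {n} d∣m+n = ∣m+n∣m⇒∣n (subst (d ∣_) (ℕ.+-comm m n) d∣m+n)

complement-mod : ∀ m {{_ : ℕ.NonZero m}} s → ∃ λ (t : Fin m) → m ∣ s + toℕ t
complement-mod m s with s ℕ.% m in eq
... | zero = fromℕ< (ℕ.>-nonZero⁻¹ m) ,
  subst (m ∣_) (sym (trans (cong (s +_) (Fin.toℕ-fromℕ< _)) (ℕ.+-identityʳ s)))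
    (m%n≡0⇒n∣m s m eq)
... | suc r = fromℕ< t<m , divides (suc (s ℕ./ m)) (begin
    s + toℕ (fromℕ< t<m)              ≡⟨ cong₂ _+_ (m≡m%n+[m/n]*n s m) (Fin.toℕ-fromℕ< t<m) ⟩
    s ℕ.% m + qm + t                  ≡⟨ cong (λ z → z + qm + t) eq ⟩
    suc r + qm + t                    ≡⟨ rearrange (suc r) qm t ⟩
    suc r + t + qm                    ≡⟨ cong (_+ qm) (ℕ.m+[n∸m]≡n (ℕ.<⇒≤ 1+r<m)) ⟩
    m + qm                            ∎)
  where
  open ≡-Reasoning
  qm = s ℕ./ m * m
  t = m ℕ.∸ suc r
  1+r<m : suc r ℕ.< m
  1+r<m = subst (ℕ._< m) eq (m%n<n s m)
  t<m : t ℕ.< m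
  t<m = ℕ.∸-monoʳ-< (s≤s z≤n) (ℕ.<⇒≤ 1+r<m)
  rearrange : ∀ a b c → a + b + c ≡ a + c + b
  rearrange = solve-∀

-- Distinct elements occupy distinct positions of the filtered list, so mapping x to the position of
-- g x is an injection between finite sets.
length-filter-≥ : ∀ {A : Set} {P : A → Set} (P? : Decidable P) {K} (xs : List A) (g : Fin K → A) →
  Injective _≡_ _≡_ g → (∀ x → g x ∈ xs) → (∀ x → P (g x)) → K ≤ length (filter P? xs)
length-filter-≥ P? xs g g-injective g∈xs Pg = Fin.injective⇒≤ {f = index ∘ g∈filter}
  (λ {x} {y} eq → g-injective
    (Membership.index-injective (setoid _) (g∈filter x) (g∈filter y) eq))
  where
  g∈filter : ∀ x → g x ∈ filter P? xs
  g∈filter x = ∈-filter⁺ P? (g∈xs x) (Pg x)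

-- Residues mod 7, the quadratic residues 1, 2, 4 first; index r + 3 is the negative of index r.
residue : Fin 6 → ℕ
residue 0F = 1
residue 1F = 2
residue 2F = 4
residue 3F = 6
residue 4F = 5
residue 5F = 3

isNonresidue : Fin 6 → Bool
isNonresidue 0F = false
isNonresidue 1F = false
isNonresidue 2F = false
isNonresidue _ = true

opposite : Fin 6 → Fin 6
opposite 0F = 3F
opposite 1F = 4F
opposite 2F = 5F
opposite 3F = 0F
opposite 4F = 1F
opposite 5F = 2F

residue-opposite : ∀ r → residue r + residue (opposite r) ≡ 7
residue-opposite = from-yes (Fin.all? λ r → residue r + residue (opposite r) ℕ.≟ 7)

opposite-irrefl : ∀ r → ¬ opposite r ≡ r
opposite-irrefl = from-yes (Fin.all? λ r → ¬? (opposite r Fin.≟ r))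

residue-injective : ∀ r r′ → residue r ≡ residue r′ → r ≡ r′
residue-injective = from-yes (Fin.all? λ r → Fin.all? λ r′ →
  (residue r ℕ.≟ residue r′) →-dec (r Fin.≟ r′))

residue-% : ∀ r → residue r ℕ.% 7 ≡ residue r
residue-% = from-yes (Fin.all? λ r → residue r ℕ.% 7 ℕ.≟ residue r)

7∤residue : ∀ r → ¬ 7 ∣ residue r
7∤residue = from-yes (Fin.all? λ r → ¬? (7 ∣? residue r))

-- Both -1 and -2 are nonresidues mod 7, so -(a + b) is neither 0 nor a nor b
-- when a and b have the same quadratic character.
third-residue : ∀ r r′ → isNonresidue r ≡ isNonresidue r′ →
  ∃ λ r″ → 7 ∣ residue r + residue r′ + residue r″ × ¬ r″ ≡ r × ¬ r″ ≡ r′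
third-residue = from-yes (Fin.all? λ r → Fin.all? λ r′ →
  (isNonresidue r Bool.≟ isNonresidue r′) →-dec Fin.any? λ r″ →
    (7 ∣? residue r + residue r′ + residue r″) ×-dec ¬? (r″ Fin.≟ r) ×-dec ¬? (r″ Fin.≟ r′))

-- The offsets 0, 1, -1, 2, -2, to be read modulo 5 + p.
offset : ℕ → Fin 5 → ℕ
offset p 0F = 0
offset p 1F = 1
offset p 2F = 4 + p
offset p 3F = 2
offset p 4F = 3 + p

offset< : ∀ p o → offset p o ℕ.< 5 + p
offset< p 0F = s≤s z≤n
offset< p 1F = s≤s (s≤s z≤n)
offset< p 2F = ℕ.≤-refl
offset< p 3F = s≤s (s≤s (s≤s z≤n))
offset< p 4F = ℕ.n≤1+n _

offset-injective : ∀ p o o′ → offset p o ≡ offset p o′ → o ≡ o′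
offset-injective p 0F 0F _ = refl
offset-injective p 0F 1F ()
offset-injective p 0F 2F ()
offset-injective p 0F 3F ()
offset-injective p 0F 4F ()
offset-injective p 1F 1F _ = refl
offset-injective p 1F 2F ()
offset-injective p 1F 3F ()
offset-injective p 1F 4F ()
offset-injective p 2F 2F _ = refl
offset-injective p 2F 3F ()
offset-injective p 2F 4F ()
offset-injective p 3F 3F _ = refl
offset-injective p 3F 4F ()
offset-injective p 4F 2F ()
offset-injective p 4F 4F _ = refl

isOuter : Fin 5 → Bool
isOuter 3F = true
isOuter 4F = true
isOuter _ = false

-- The inner offsets 0, 1, -1 sum to 0, and so do 2, -2, 0. The last clause serves the pairs {1, -1}
-- and {2, -2}.
third-offset : Fin 5 → Fin 5 → Fin 5
third-offset 0F 1F = 2F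
third-offset 1F 0F = 2F
third-offset 0F 2F = 1F
third-offset 2F 0F = 1F
third-offset _ _ = 0F

third-offset-∣ : ∀ p o o′ → isOuter o ≡ isOuter o′ → ¬ o ≡ o′ →
  5 + p ∣ offset p o + offset p o′ + offset p (third-offset o o′)
third-offset-∣ p o o′ same o≢o′ = ∣-reflexive (sym (sum≡m o o′ same o≢o′))
  where
  sum≡m : ∀ o o′ → isOuter o ≡ isOuter o′ → ¬ o ≡ o′ →
    offset p o + offset p o′ + offset p (third-offset o o′) ≡ 5 + p
  sum≡m 0F 1F _ _ = refl
  sum≡m 1F 0F _ _ = refl
  sum≡m 0F 2F _ _ = ℕ.+-comm (4 + p) 1
  sum≡m 2F 0F _ _ = trans (cong (_+ 1) (ℕ.+-identityʳ (4 + p))) (ℕ.+-comm (4 + p) 1)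
  sum≡m 1F 2F _ _ = ℕ.+-identityʳ (5 + p)
  sum≡m 2F 1F _ _ = trans (ℕ.+-identityʳ (4 + p + 1)) (ℕ.+-comm (4 + p) 1)
  sum≡m 3F 4F _ _ = ℕ.+-identityʳ (5 + p)
  sum≡m 4F 3F _ _ = trans (ℕ.+-identityʳ (3 + p + 2)) (ℕ.+-comm (3 + p) 2)
  sum≡m 0F 0F _ o≢o = ⊥-elim (o≢o refl)
  sum≡m 1F 1F _ o≢o = ⊥-elim (o≢o refl)
  sum≡m 2F 2F _ o≢o = ⊥-elim (o≢o refl)
  sum≡m 3F 3F _ o≢o = ⊥-elim (o≢o refl)
  sum≡m 4F 4F _ o≢o = ⊥-elim (o≢o refl)
  sum≡m 0F 3F ()
  sum≡m 0F 4F ()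
  sum≡m 1F 3F ()
  sum≡m 1F 4F ()
  sum≡m 2F 3F ()
  sum≡m 2F 4F ()

-- The offsets used when n ≡ j mod 6.  Two inner ones (0, ±1), and likewise two outer ones (±2),
-- must be collinear with a third one in use, which rules out {0, 1} for j = 2.
extra : (j : Fin 6) → Fin (toℕ j) → Fin 5
extra 2F 1F = 3F
extra j k = inject≤ k (Fin.toℕ≤pred[n] j)

extra-injective : ∀ j k k′ → extra j k ≡ extra j k′ → k ≡ k′
extra-injective = from-yes (Fin.all? λ j → Fin.all? λ k → Fin.all? λ k′ →
  (extra j k Fin.≟ extra j k′) →-dec (k Fin.≟ k′))

third-extra : ∀ j k k′ → isOuter (extra j k) ≡ isOuter (extra j k′) → ¬ k ≡ k′ →
  ∃ λ k″ → extra j k″ ≡ third-offset (extra j k) (extra j k′) × ¬ k″ ≡ k × ¬ k″ ≡ k′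
third-extra = from-yes (Fin.all? λ j → Fin.all? λ k → Fin.all? λ k′ →
  (isOuter (extra j k) Bool.≟ isOuter (extra j k′)) →-dec ¬? (k Fin.≟ k′) →-dec Fin.any? λ k″ →
    (extra j k″ Fin.≟ third-offset (extra j k) (extra j k′)) ×-dec
      ¬? (k″ Fin.≟ k) ×-dec ¬? (k″ Fin.≟ k′))

-- With m = 5 + p, the number 3 + u lies between 3 and m - 3, too far from the multiples of m for a
-- shift by at most 2. For the offsets -1 and -2, represented by m - 1 and m - 2, one m is first
-- removed.
∤-near-multiple : ∀ p u o → u ℕ.< p → ¬ 5 + p ∣ 3 + u + offset p o
∤-near-multiple p u o u<p = go o
  where
  small : ∀ c → c ≤ 5 → 0 ℕ.< c → ¬ 5 + p ∣ c + u
  small (suc c) c≤5 _ = >⇒∤ (ℕ.+-mono-≤-< c≤5 u<p)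
  shifted : ∀ c → c ≤ 5 → 0 ℕ.< c → ¬ 5 + p ∣ (5 + p) + (c + u)
  shifted c c≤5 0<c m∣ = small c c≤5 0<c (∣m+n∣m⇒∣n m∣ (divides 1 (sym (ℕ.*-identityˡ _))))
  go : ∀ o → ¬ 5 + p ∣ 3 + u + offset p o
  go 0F = small 3 (from-yes (3 ℕ.≤? 5)) (s≤s z≤n) ∘ subst (5 + p ∣_) (eq u)
    where
    eq : ∀ u → 3 + u + 0 ≡ 3 + u
    eq = solve-∀
  go 1F = small 4 (from-yes (4 ℕ.≤? 5)) (s≤s z≤n) ∘ subst (5 + p ∣_) (eq u)
    where
    eq : ∀ u → 3 + u + 1 ≡ 4 + u
    eq = solve-∀
  go 3F = small 5 (from-yes (5 ℕ.≤? 5)) (s≤s z≤n) ∘ subst (5 + p ∣_) (eq u)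
    where
    eq : ∀ u → 3 + u + 2 ≡ 5 + u
    eq = solve-∀
  go 2F = shifted 2 (from-yes (2 ℕ.≤? 5)) (s≤s z≤n) ∘ subst (5 + p ∣_) (eq u p)
    where
    eq : ∀ u p → 3 + u + (4 + p) ≡ (5 + p) + (2 + u)
    eq = solve-∀
  go 4F = shifted 1 (from-yes (1 ℕ.≤? 5)) (s≤s z≤n) ∘ subst (5 + p ∣_) (eq u p)
    where
    eq : ∀ u p → 3 + u + (3 + p) ≡ (5 + p) + (1 + u)
    eq = solve-∀

-- The labelled configuration and the count of its edges.

module Configuration (p : ℕ) (j : Fin 6) where
  -- Writing m as 5 + p makes p the number of partners left for a given t in the opposite class once
  -- the five offsets are avoided.
  m : ℕ
  m = 5 + p

  N : ℕ
  N = m * 7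

  n : ℕ
  n = 6 * m + toℕ j

  Label : Set
  Label = Fin 6 × Fin m ⊎ Fin (toℕ j)

  value : Label → ℕ
  value (inj₁ (r , t)) = residue r + toℕ t * 7
  value (inj₂ k) = offset p (extra j k) * 7

  -- The two bipartitions can share one pair of colours, because a pair of an old and an added label
  -- has a third point whatever its colours are.
  colour : Label → Bool
  colour (inj₁ (r , t)) = isNonresidue r
  colour (inj₂ k) = isOuter (extra j k)

  residue<7 : ∀ r → residue r ℕ.< 7
  residue<7 = from-yes (Fin.all? λ r → residue r ℕ.<? 7)

  value<N : ∀ l → value l ℕ.< N
  value<N (inj₁ (r , t)) = ℕ.<-≤-trans (ℕ.+-monoˡ-< (toℕ t * 7) (residue<7 r))
    (ℕ.*-monoˡ-≤ 7 (Fin.toℕ<n t))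
  value<N (inj₂ k) = ℕ.*-monoˡ-< 7 (offset< p (extra j k))

  value-injective : ∀ l l′ → value l ≡ value l′ → l ≡ l′
  value-injective (inj₁ (r , t)) (inj₁ (r′ , t′)) eq
    with residue-injective r r′ (begin
      residue r                          ≡⟨ residue-% r ⟨
      residue r ℕ.% 7                    ≡⟨ [m+kn]%n≡m%n (residue r) (toℕ t) 7 ⟨
      (residue r + toℕ t * 7) ℕ.% 7      ≡⟨ cong (ℕ._% 7) eq ⟩
      (residue r′ + toℕ t′ * 7) ℕ.% 7    ≡⟨ [m+kn]%n≡m%n (residue r′) (toℕ t′) 7 ⟩
      residue r′ ℕ.% 7                   ≡⟨ residue-% r′ ⟩
      residue r′                         ∎)
    where open ≡-Reasoning
  ... | refl = cong (λ t → inj₁ (r , t)) (Fin.toℕ-injective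
    (ℕ.*-cancelʳ-≡ (toℕ t) (toℕ t′) 7 (ℕ.+-cancelˡ-≡ (residue r) _ _ eq)))
  value-injective (inj₁ (r , t)) (inj₂ k) eq = ⊥-elim (7∤residue r (∣m+n∣n⇒∣m
    (subst (7 ∣_) (sym eq) (n∣m*n (offset p (extra j k)))) (n∣m*n (toℕ t))))
  value-injective (inj₂ k) (inj₁ (r , t)) eq = ⊥-elim (7∤residue r (∣m+n∣n⇒∣m
    (subst (7 ∣_) eq (n∣m*n (offset p (extra j k)))) (n∣m*n (toℕ t))))
  value-injective (inj₂ k) (inj₂ k′) eq = cong inj₂ (extra-injective j k k′
    (offset-injective p _ _ (ℕ.*-cancelʳ-≡ (offset p (extra j k)) (offset p (extra j k′)) 7 eq)))

  Balanced : Label → Label → Label → Set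
  Balanced l l′ l″ = N ∣ value l + value l′ + value l″

  ∣⇒*7∣ : ∀ {s v} → v ≡ s * 7 → m ∣ s → N ∣ v
  ∣⇒*7∣ refl m∣s = *-monoˡ-∣ 7 m∣s

  balanced-swap : ∀ l l′ l″ → Balanced l l′ l″ → Balanced l′ l l″
  balanced-swap l l′ l″ = subst (λ s → N ∣ s + value l″) (ℕ.+-comm (value l) (value l′))

  -- The third point has class -r ≠ r. The residues r and -r sum to 7, which contributes the carry 1
  -- to the condition mod m.
  third-mixed : ∀ rt k → ∃ λ l″ → Balanced (inj₁ rt) (inj₂ k) l″ × ¬ l″ ≡ inj₁ rt × ¬ l″ ≡ inj₂ k
  third-mixed (r , t) k with complement-mod m (1 + toℕ t + offset p (extra j k))
  ... | t″ , m∣s = inj₁ (opposite r , t″) , ∣⇒*7∣ (begin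
      residue r + toℕ t * 7 + o * 7 + (residue (opposite r) + toℕ t″ * 7)
        ≡⟨ rearrange (residue r) (residue (opposite r)) (toℕ t) o (toℕ t″) ⟩
      residue r + residue (opposite r) + (toℕ t + o + toℕ t″) * 7
        ≡⟨ cong (_+ (toℕ t + o + toℕ t″) * 7) (residue-opposite r) ⟩
      (1 + toℕ t + o + toℕ t″) * 7 ∎) m∣s ,
    (λ eq → opposite-irrefl r (,-injectiveˡ (inj₁-injective eq))) , λ ()
    where
    open ≡-Reasoning
    o = offset p (extra j k)
    rearrange : ∀ a b t o t″ → a + t * 7 + o * 7 + (b + t″ * 7) ≡
      a + b + (t + o + t″) * 7
    rearrange = solve-∀

  third-classes : ∀ r t r′ t′ →
    (∃ λ r″ → 7 ∣ residue r + residue r′ + residue r″ × ¬ r″ ≡ r × ¬ r″ ≡ r′) →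
    ∃ λ l″ → Balanced (inj₁ (r , t)) (inj₁ (r′ , t′)) l″ × ¬ l″ ≡ inj₁ (r , t) × ¬ l″ ≡ inj₁ (r′ , t′)
  third-classes r t r′ t′ (r″ , divides q sum≡q*7 , r″≢r , r″≢r′)
    with complement-mod m (q + toℕ t + toℕ t′)
  ... | t″ , m∣s = inj₁ (r″ , t″) , ∣⇒*7∣ (begin
      residue r + toℕ t * 7 + (residue r′ + toℕ t′ * 7) + (residue r″ + toℕ t″ * 7)
        ≡⟨ rearrange (residue r) (residue r′) (residue r″) (toℕ t) (toℕ t′) (toℕ t″) ⟩
      residue r + residue r′ + residue r″ + (toℕ t + toℕ t′ + toℕ t″) * 7
        ≡⟨ cong (_+ (toℕ t + toℕ t′ + toℕ t″) * 7) sum≡q*7 ⟩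
      q * 7 + (toℕ t + toℕ t′ + toℕ t″) * 7
        ≡⟨ collect q (toℕ t) (toℕ t′) (toℕ t″) ⟩
      (q + toℕ t + toℕ t′ + toℕ t″) * 7 ∎) m∣s ,
    r″≢r ∘ ,-injectiveˡ ∘ inj₁-injective , r″≢r′ ∘ ,-injectiveˡ ∘ inj₁-injective
    where
    open ≡-Reasoning
    rearrange : ∀ a b c t t′ t″ → a + t * 7 + (b + t′ * 7) + (c + t″ * 7) ≡
      a + b + c + (t + t′ + t″) * 7
    rearrange = solve-∀
    collect : ∀ q t t′ t″ → q * 7 + (t + t′ + t″) * 7 ≡ (q + t + t′ + t″) * 7
    collect = solve-∀

  third-extras : ∀ k k′ →
    5 + p ∣ offset p (extra j k) + offset p (extra j k′) +
      offset p (third-offset (extra j k) (extra j k′)) →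
    (∃ λ k″ → extra j k″ ≡ third-offset (extra j k) (extra j k′) × ¬ k″ ≡ k × ¬ k″ ≡ k′) →
    ∃ λ l″ → Balanced (inj₂ k) (inj₂ k′) l″ × ¬ l″ ≡ inj₂ k × ¬ l″ ≡ inj₂ k′
  third-extras k k′ m∣ (k″ , eq , k″≢k , k″≢k′) = inj₂ k″ ,
    ∣⇒*7∣ (collect (offset p (extra j k)) (offset p (extra j k′)) (offset p (extra j k″)))
      (subst (λ o → m ∣ offset p (extra j k) + offset p (extra j k′) + offset p o) (sym eq) m∣) ,
    k″≢k ∘ inj₂-injective , k″≢k′ ∘ inj₂-injective
    where
    collect : ∀ a b c → a * 7 + b * 7 + c * 7 ≡ (a + b + c) * 7
    collect = solve-∀

  third : ∀ l l′ → colour l ≡ colour l′ → ¬ l ≡ l′ →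
    ∃ λ l″ → Balanced l l′ l″ × ¬ l″ ≡ l × ¬ l″ ≡ l′
  third (inj₁ (r , t)) (inj₁ (r′ , t′)) same _ = third-classes r t r′ t′ (third-residue r r′ same)
  third (inj₁ rt) (inj₂ k) _ _ = third-mixed rt k
  third (inj₂ k) (inj₁ rt) _ _ =
    let l″ , balanced , l″≢rt , l″≢k = third-mixed rt k
    in l″ , balanced-swap (inj₁ rt) (inj₂ k) l″ balanced , l″≢k , l″≢rt
  third (inj₂ k) (inj₂ k′) same k≢k′ = third-extras k k′
    (third-offset-∣ p (extra j k) (extra j k′) same (k≢k′ ∘ cong inj₂ ∘ extra-injective j k k′))
    (third-extra j k k′ same (k≢k′ ∘ cong inj₂))

  -- 2 + u ≡ t + t′ mod m keeps 1 + t + t′ at distance at least 3 from the multiples of m,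
  -- hence away from every offset.
  partner : ∀ (t : Fin m) (u : Fin p) →
    ∃ λ (t′ : Fin m) → (toℕ t + toℕ t′ ≡ 2 + toℕ u ⊎ toℕ t + toℕ t′ ≡ m + (2 + toℕ u))
  partner t u with toℕ t ℕ.≤? 2 + toℕ u
  ... | yes t≤2+u = fromℕ< t′<m ,
      inj₁ (trans (cong (toℕ t +_) (Fin.toℕ-fromℕ< t′<m)) (ℕ.m+[n∸m]≡n t≤2+u))
    where
    t′<m : 2 + toℕ u ℕ.∸ toℕ t ℕ.< m
    t′<m = ℕ.≤-<-trans (ℕ.m∸n≤m (2 + toℕ u) (toℕ t)) (ℕ.+-mono-≤-< (from-yes (2 ℕ.≤? 5)) (Fin.toℕ<n u))
  ... | no t≰2+u = fromℕ< t′<m ,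
      inj₂ (trans (cong (toℕ t +_) (Fin.toℕ-fromℕ< t′<m)) (ℕ.m+[n∸m]≡n t≤m+2+u))
    where
    t≤m+2+u : toℕ t ≤ m + (2 + toℕ u)
    t≤m+2+u = ℕ.≤-trans (ℕ.<⇒≤ (Fin.toℕ<n t)) (ℕ.m≤m+n m _)
    t′<m : m + (2 + toℕ u) ℕ.∸ toℕ t ℕ.< m
    t′<m = ℕ.+-cancelˡ-< (toℕ t) _ m (subst₂ ℕ._<_ (sym (ℕ.m+[n∸m]≡n t≤m+2+u)) (ℕ.+-comm m (toℕ t))
      (ℕ.+-monoʳ-< m (ℕ.≰⇒> t≰2+u)))

  2+u≢m+ : ∀ (u u′ : Fin p) → ¬ 2 + toℕ u ≡ m + (2 + toℕ u′)
  2+u≢m+ u u′ = ℕ.<⇒≢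
    (ℕ.<-≤-trans (ℕ.+-mono-≤-< (from-yes (2 ℕ.≤? 5)) (Fin.toℕ<n u)) (ℕ.m≤m+n m _))

  partner-injective : ∀ t u u′ → proj₁ (partner t u) ≡ proj₁ (partner t u′) → u ≡ u′
  partner-injective t u u′ eq with partner t u | partner t u′
  partner-injective t u u′ refl | t′ , inj₁ e | .t′ , inj₁ e′ =
    Fin.toℕ-injective (ℕ.+-cancelˡ-≡ 2 _ _ (trans (sym e) e′))
  partner-injective t u u′ refl | t′ , inj₂ e | .t′ , inj₂ e′ =
    Fin.toℕ-injective (ℕ.+-cancelˡ-≡ 2 _ _ (ℕ.+-cancelˡ-≡ m _ _ (trans (sym e) e′)))
  partner-injective t u u′ refl | t′ , inj₁ e | .t′ , inj₂ e′ =
    ⊥-elim (2+u≢m+ u u′ (trans (sym e) e′))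
  partner-injective t u u′ refl | t′ , inj₂ e | .t′ , inj₁ e′ =
    ⊥-elim (2+u≢m+ u′ u (trans (sym e′) e))

  -- The two parameters sum to (1 + t + t′) * 7. No parameter prime to 7 completes this to a
  -- multiple of 7, and for an added parameter the condition mod m reads m ∣ 3 + u + offset, which
  -- `∤-near-multiple` excludes.
  partner-unbalanced : ∀ r t u l″ →
    ¬ Balanced (inj₁ (r , t)) (inj₁ (opposite r , proj₁ (partner t u))) l″
  partner-unbalanced r t u l″ N∣ with partner t u
  ... | t′ , t+t′≡ = unbalanced l″ (subst (λ s → N ∣ s + value l″) (begin
      residue r + toℕ t * 7 + (residue (opposite r) + toℕ t′ * 7)
        ≡⟨ rearrange (residue r) (residue (opposite r)) (toℕ t) (toℕ t′) ⟩
      residue r + residue (opposite r) + (toℕ t + toℕ t′) * 7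
        ≡⟨ cong (_+ (toℕ t + toℕ t′) * 7) (residue-opposite r) ⟩
      (1 + (toℕ t + toℕ t′)) * 7 ∎) N∣)
    where
    open ≡-Reasoning
    rearrange : ∀ a b t t′ → a + t * 7 + (b + t′ * 7) ≡ a + b + (t + t′) * 7
    rearrange = solve-∀
    reduce : ∀ {s} o → s ≡ 2 + toℕ u ⊎ s ≡ m + (2 + toℕ u) →
      m ∣ 1 + s + o → m ∣ 3 + toℕ u + o
    reduce o (inj₁ refl) m∣ = m∣
    reduce o (inj₂ refl) m∣ = ∣m+n∣m⇒∣n (subst (m ∣_) (shift m (toℕ u) o) m∣)
      (divides 1 (sym (ℕ.*-identityˡ m)))
      where
      shift : ∀ m u o → 1 + (m + (2 + u)) + o ≡ m + (3 + u + o)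
      shift = solve-∀
    unbalanced : ∀ l → ¬ N ∣ (1 + (toℕ t + toℕ t′)) * 7 + value l
    unbalanced (inj₁ (r″ , t″)) N∣ = 7∤residue r″ (∣m+n∣n⇒∣m
      (∣m+n∣m⇒∣n (∣-trans (n∣m*n m) N∣) (n∣m*n (1 + (toℕ t + toℕ t′)))) (n∣m*n (toℕ t″)))
    unbalanced (inj₂ k) N∣ = ∤-near-multiple p (toℕ u) (extra j k) (Fin.toℕ<n u)
      (reduce (offset p (extra j k)) t+t′≡ (*-cancelʳ-∣ 7 (subst (N ∣_)
        (sym (ℕ.*-distribʳ-+ 7 (1 + (toℕ t + toℕ t′)) (offset p (extra j k)))) N∣)))

  label : Fin n → Label
  label i = map₁ (remQuot m) (splitAt (6 * m) i)

  position : Label → Fin n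
  position (inj₁ (r , t)) = combine r t ↑ˡ toℕ j
  position (inj₂ k) = 6 * m ↑ʳ k

  label-position : ∀ l → label (position l) ≡ l
  label-position (inj₁ (r , t)) = trans
    (cong (map₁ (remQuot m)) (Fin.splitAt-↑ˡ (6 * m) (combine r t) (toℕ j)))
    (cong inj₁ (Fin.remQuot-combine r t))
  label-position (inj₂ k) = cong (map₁ (remQuot m)) (Fin.splitAt-↑ʳ (6 * m) (toℕ j) k)

  position-injective : ∀ {l l′} → position l ≡ position l′ → l ≡ l′
  position-injective {l} {l′} eq =
    trans (sym (label-position l)) (trans (cong label eq) (label-position l′))

  position-label : ∀ i → position (label i) ≡ i
  position-label i = trans (lemma (splitAt (6 * m) i)) (Fin.join-splitAt (6 * m) (toℕ j) i)
    where
    lemma : ∀ s → position (map₁ (remQuot m) s) ≡ join (6 * m) (toℕ j) s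
    lemma (inj₁ x) = cong (_↑ˡ toℕ j) (Fin.combine-remQuot {6} m x)
    lemma (inj₂ k) = refl

  label-injective : ∀ {i i′} → label i ≡ label i′ → i ≡ i′
  label-injective {i} {i′} eq =
    trans (sym (position-label i)) (trans (cong position eq) (position-label i′))

  -- Each edge is recorded from its quadratic residue end: one of three classes, then t, then one of
  -- the p partners in the opposite class.
  EdgeCode : Set
  EdgeCode = Fin 3 × Fin m × Fin p

  decode : Fin (3 * (m * p)) → EdgeCode
  decode x = let r , y = remQuot {3} (m * p) x in r , remQuot {m} p y

  decode-injective : Injective _≡_ _≡_ decode
  decode-injective {x} {x′} eq = begin
    x                                                 ≡⟨ encode-decode x ⟨
    encode (decode x)                                 ≡⟨ cong encode eq ⟩
    encode (decode x′)                                ≡⟨ encode-decode x′ ⟩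
    x′                                                ∎
    where
    open ≡-Reasoning
    encode : EdgeCode → Fin (3 * (m * p))
    encode (r , t , u) = combine r (combine t u)
    encode-decode : ∀ x → encode (decode x) ≡ x
    encode-decode x = trans
      (cong (combine (proj₁ (remQuot {3} (m * p) x)))
        (Fin.combine-remQuot {m} p (proj₂ (remQuot {3} (m * p) x))))
      (Fin.combine-remQuot {3} (m * p) x)

  edge : EdgeCode → Fin n × Fin n
  edge (r , t , u) =
    position (inj₁ (r ↑ˡ 3 , t)) , position (inj₁ (opposite (r ↑ˡ 3) , proj₁ (partner t u)))

  edge-injective : Injective _≡_ _≡_ edge
  edge-injective {r , t , u} {r′ , t′ , u′} eq
    with ,-injective (inj₁-injective (position-injective {inj₁ (r ↑ˡ 3 , t)} {inj₁ (r′ ↑ˡ 3 , t′)}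
      (,-injectiveˡ eq)))
  ... | r≡r′ , refl with Fin.↑ˡ-injective 3 r r′ r≡r′
  ... | refl = cong (λ u → r , t , u) (partner-injective t u u′
    (,-injectiveʳ (inj₁-injective (position-injective
      {inj₁ (opposite (r ↑ˡ 3) , proj₁ (partner t u))} {inj₁ (opposite (r ↑ˡ 3) , proj₁ (partner t u′))}
      (,-injectiveʳ eq)))))

  -- The quadratic residues come first in the indexing and `combine` is monotone in the class, so no
  -- edge is listed in the wrong order.
  edge-< : ∀ e → proj₁ (edge e) Fin.< proj₂ (edge e)
  edge-< (r , t , u) = subst₂ ℕ._<_
    (sym (Fin.toℕ-↑ˡ (combine (r ↑ˡ 3) t) (toℕ j)))
    (sym (Fin.toℕ-↑ˡ (combine (opposite (r ↑ˡ 3)) (proj₁ (partner t u))) (toℕ j)))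
    (Fin.combine-monoˡ-< t (proj₁ (partner t u)) (r<opposite r))
    where
    r<opposite : ∀ (r : Fin 3) → r ↑ˡ 3 Fin.< opposite (r ↑ˡ 3)
    r<opposite = from-yes (Fin.all? λ (r : Fin 3) → r ↑ˡ 3 Fin.<? opposite (r ↑ˡ 3))

  -- Here n² = 36m² + 12mj + j². Since 36m² = 36mp + 180m and 12mj ≤ 60m, the excess is at most 240m
  -- = 40 · 6m, up to j² ≤ 40j; this is the origin of 10/3 = 40/12.
  edge-count : n * n ≤ 12 * (3 * (m * p)) + 40 * n
  edge-count = begin
    n * n
      ≡⟨ expand p (toℕ j) ⟩
    36 * (m * p) + 180 * m + 12 * (m * toℕ j) + toℕ j * toℕ j
      ≤⟨ ℕ.+-mono-≤ (ℕ.+-monoʳ-≤ (36 * (m * p) + 180 * m) (ℕ.*-monoʳ-≤ 12 (ℕ.*-monoʳ-≤ m j≤5)))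
           (ℕ.*-monoˡ-≤ (toℕ j) (ℕ.≤-trans j≤5 (from-yes (5 ℕ.≤? 40)))) ⟩
    36 * (m * p) + 180 * m + 12 * (m * 5) + 40 * toℕ j
      ≡⟨ collect p (toℕ j) ⟩
    12 * (3 * (m * p)) + 40 * n ∎
    where
    open ℕ.≤-Reasoning
    j≤5 : toℕ j ≤ 5
    j≤5 = Fin.toℕ≤pred[n] j
    expand : ∀ p j → (6 * (5 + p) + j) * (6 * (5 + p) + j) ≡
      36 * ((5 + p) * p) + 180 * (5 + p) + 12 * ((5 + p) * j) + j * j
    expand = solve-∀
    collect : ∀ p j →
      36 * ((5 + p) * p) + 180 * (5 + p) + 12 * ((5 + p) * 5) + 40 * j ≡
      12 * (3 * ((5 + p) * p)) + 40 * (6 * (5 + p) + j)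
    collect = solve-∀

ord-≥ : (R : RealField) → let open Plane R in
  ∀ {n K} (A : Fin n → Point) (g : Fin K → Fin n × Fin n) → Injective _≡_ _≡_ g →
  (∀ x → proj₁ (g x) Fin.< proj₂ (g x)) → (∀ x → OrdinaryPair A (proj₁ (g x)) (proj₂ (g x))) →
  K ≤ ord A
ord-≥ R A g g-injective g-< g-ordinary = length-filter-≥ _ _ g g-injective
  (λ x → ∈-cartesianProduct⁺ (∈-allFin (proj₁ (g x))) (∈-allFin (proj₂ (g x))))
  (λ x → g-< x , g-ordinary x)

-- The points in the plane and the required properties.

module Placement (R : RealField) (p : ℕ) (j : Fin 6) (y : RealField.ℝ R)
  (u-N : Chebyshev.u R y (Configuration.N p j) ≡ RealField.0ᵣ R)
  (u-positive : ∀ k → 0 ℕ.< k → k ℕ.< Configuration.N p j →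
    RealField._<ᵣ_ R (RealField.0ᵣ R) (Chebyshev.u R y k))
  where
  open Configuration p j
  open Plane R
  open TorsionPoints R y N u-N u-positive

  A : Fin n → Point
  A i = pt (value (label i))

  value-label-injective : ∀ {i i′} → value (label i) ≡ value (label i′) → i ≡ i′
  value-label-injective {i} {i′} eq = label-injective (value-injective (label i) (label i′) eq)

  A-injective : Injective _≡_ _≡_ A
  A-injective {i} {i′} eq =
    value-label-injective (pt-injective (value<N (label i)) (value<N (label i′)) eq)

  collinear⇒balanced : ∀ {a b c} → ¬ a ≡ b → ¬ b ≡ c → ¬ c ≡ a → Collinear (A a) (A b) (A c) →
    Balanced (label a) (label b) (label c)
  collinear⇒balanced {a} {b} {c} a≢b b≢c c≢a = collinear⇒∣
    (value<N (label a)) (value<N (label b)) (value<N (label c))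
    (a≢b ∘ value-label-injective) (b≢c ∘ value-label-injective) (c≢a ∘ value-label-injective)

  ordinary⇒colours-differ : ∀ {i i′} → OrdinaryPair A i i′ → ¬ colour (label i) ≡ colour (label i′)
  ordinary⇒colours-differ {i} {i′} (i≢i′ , only) same = contradict
    (third (label i) (label i′) same (i≢i′ ∘ label-injective))
    where
    contradict : ¬ (∃ λ l″ → Balanced (label i) (label i′) l″ × ¬ l″ ≡ label i × ¬ l″ ≡ label i′)
    contradict (l″ , balanced , l″≢l , l″≢l′) =
      [ (λ eq → l″≢l (trans (sym (label-position l″)) (cong label eq)))
      , (λ eq → l″≢l′ (trans (sym (label-position l″)) (cong label eq))) ]′
      (only (position l″)
        (∣⇒collinear (value<N (label i)) (value<N (label i′)) (value<N (label (position l″)))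
          (subst (Balanced (label i) (label i′)) (sym (label-position l″)) balanced)))

  -- Ordinary pairs are properly 2-coloured, so three members of a clique already contradict the
  -- pigeonhole principle.
  noOrdinaryClique : ∀ {r} → 3 ≤ r → NoOrdinaryClique A r
  noOrdinaryClique {r} 3≤r f f-injective ordinary = pigeonhole (c 0F) (c 1F) (c 2F)
    (differ λ ()) (differ λ ()) (differ λ ())
    where
    g : Fin 3 → Fin r
    g s = inject≤ s 3≤r
    c : Fin 3 → Bool
    c s = colour (label (f (g s)))
    differ : ∀ {s t} → ¬ s ≡ t → ¬ c s ≡ c t
    differ {s} {t} s≢t = ordinary⇒colours-differ
      (ordinary (g s) (g t) (s≢t ∘ Fin.inject≤-injective 3≤r 3≤r s t))
    pigeonhole : ∀ a b c → ¬ a ≡ b → ¬ b ≡ c → ¬ ¬ a ≡ c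
    pigeonhole false false _ a≢b _ _ = a≢b refl
    pigeonhole true true _ a≢b _ _ = a≢b refl
    pigeonhole false true false _ _ a≢c = a≢c refl
    pigeonhole false true true _ b≢c _ = b≢c refl
    pigeonhole true false true _ _ a≢c = a≢c refl
    pigeonhole true false false _ b≢c _ = b≢c refl

  -- Of four points on a line, the third and the fourth each complete the first two to a sum
  -- divisible by N, so they have the same parameter.
  atMostOnLines : ∀ {k} → 4 ≤ k → AtMostOnLines A k
  atMostOnLines {k} 4≤k L f f-injective f∈L = distinct {2F} {3F} (λ ())
    (value-label-injective (third-unique (v 0F + v 1F) (value<N (label (g 2F))) (value<N (label (g 3F)))
      (balanced 0F 1F 2F (λ ()) (λ ()) (λ ())) (balanced 0F 1F 3F (λ ()) (λ ()) (λ ()))))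
    where
    g : Fin 4 → Fin n
    g s = f (inject≤ s 4≤k)
    v : Fin 4 → ℕ
    v s = value (label (g s))
    distinct : ∀ {s t} → ¬ s ≡ t → ¬ g s ≡ g t
    distinct {s} {t} s≢t = s≢t ∘ Fin.inject≤-injective 4≤k 4≤k s t ∘ f-injective
    balanced : ∀ s t w → ¬ s ≡ t → ¬ t ≡ w → ¬ w ≡ s → N ∣ v s + v t + v w
    balanced s t w s≢t t≢w w≢s = collinear⇒balanced (distinct s≢t) (distinct t≢w) (distinct w≢s)
      (Collinearity.∈ₗ⇒collinear R {A (g s)} {A (g t)} {A (g w)} L
        (f∈L (inject≤ s 4≤k)) (f∈L (inject≤ t 4≤k)) (f∈L (inject≤ w 4≤k)))

  -- The labels are free variables so that equations such as `label-position` can be matched with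
  -- `refl`.
  unbalanced⇒ordinary : ∀ {i i′ l l′} → label i ≡ l → label i′ ≡ l′ → ¬ i ≡ i′ →
    (∀ l″ → ¬ Balanced l l′ l″) → OrdinaryPair A i i′
  unbalanced⇒ordinary {i} {i′} refl refl i≢i′ unbalanced = i≢i′ , only
    where
    only : ∀ w → Collinear (A i) (A i′) (A w) → w ≡ i ⊎ w ≡ i′
    only w collinear = cases (w Fin.≟ i) (w Fin.≟ i′)
      where
      cases : Dec (w ≡ i) → Dec (w ≡ i′) → w ≡ i ⊎ w ≡ i′
      cases (yes w≡i) _ = inj₁ w≡i
      cases (no _) (yes w≡i′) = inj₂ w≡i′
      cases (no w≢i) (no w≢i′) =
        ⊥-elim (unbalanced (label w) (collinear⇒balanced i≢i′ (w≢i′ ∘ sym) w≢i collinear))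

  edge-ordinary : ∀ e → OrdinaryPair A (proj₁ (edge e)) (proj₂ (edge e))
  edge-ordinary (r , t , u) = unbalanced⇒ordinary
    (label-position (inj₁ (r Fin.↑ˡ 3 , t)))
    (label-position (inj₁ (opposite (r Fin.↑ˡ 3) , proj₁ (partner t u))))
    (Fin.<⇒≢ (edge-< (r , t , u))) (partner-unbalanced (r Fin.↑ˡ 3) t u)

  3*m*p≤ord : 3 * (m * p) ≤ ord A
  3*m*p≤ord = ord-≥ R A (edge ∘ decode) (decode-injective ∘ edge-injective)
    (λ x → edge-< (decode x)) (λ x → edge-ordinary (decode x))

  placement : ∀ {r k} → 3 ≤ r → 4 ≤ k → Σ (Fin n → Point) (λ A →
    Injective _≡_ _≡_ A × AtMostOnLines A k ×
    NoOrdinaryClique A r × n * n ≤ 12 * ord A + 40 * n)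
  placement 3≤r 4≤k = A , A-injective , atMostOnLines 4≤k , noOrdinaryClique 3≤r ,
    ℕ.≤-trans edge-count (ℕ.+-monoˡ-≤ (40 * n) (ℕ.*-monoʳ-≤ 12 3*m*p≤ord))

decomposition : ∀ n → 72 ≤ n → ∃ λ p → ∃ λ j → Configuration.n p j ≡ n
decomposition n 72≤n with n divMod 6
... | result q j refl with ℕ.m≤n⇒∃[o]m+o≡n 5≤q
  where
  5≤q : 5 ≤ q
  -- From q ≤ 4 and j ≤ 5 it would follow that n ≤ 5 + 24 = 29.
  5≤q = ℕ.≰⇒> λ q≤4 → ℕ.<⇒≱
    (ℕ.≤-<-trans (ℕ.+-mono-≤ (Fin.toℕ≤pred[n] j) (ℕ.*-monoˡ-≤ 6 q≤4)) (from-yes (29 ℕ.<? 72))) 72≤n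
... | p , refl = p , j , trans (ℕ.+-comm (6 * (5 + p)) (toℕ j)) (cong (toℕ j +_) (ℕ.*-comm 6 (5 + p)))

theorem2p1 : (R : RealField) (r k n : ℕ) → 3 ≤ r → 4 ≤ k → 72 ≤ n →
    Σ (Fin n → Plane.Point R) (λ A →
    Injective _≡_ _≡_ A × Plane.AtMostOnLines R A k ×
    Plane.NoOrdinaryClique R A r × n * n ≤ 12 * Plane.ord R A + 40 * n)
theorem2p1 R r k n 3≤r 4≤k 72≤n with decomposition n 72≤n
... | p , j , refl =
  let y , u-N , u-positive = Chebyshev.u-root R (Configuration.N p j) (s≤s (s≤s z≤n))
  in Placement.placement R p j y u-N u-positive 3≤r 4≤k
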